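{- For every nonnegative integer $k$ and every integer $n\ge\frac{k+7}{2}$, the difference $\mathrm{av}_{n+1}^k(1324,1342)-\mathrm{av}_n^k(1324,1342)$ is nonnegative, and equals the coefficient of $x^k$ in the generating function $$x^{n-1}(2+2x)\,C_{1324,1342}(x)=x^{n-1}(2+2x)\cdot\prod_{i\ge 1}\frac{1+x^i}{1-x^i}.$$ In particular, when $n\ge\frac{k+7}{2}$, $$\mathrm{av}_n^k(1324,1342)=[x^k]\left(\frac{1-x-x^{n-1}(2+2x)}{1-x}\cdot\prod_{i\ge 1}\frac{1+x^i}{1-x^i}\right).$$
   Context: $\mathrm{av}_n^k(B)$ is the number of permutations in $S_n$ with exactly $k$ inversions (pairs $i<j$ with $\pi_i>\pi_j$) that avoid every pattern in $B$; a permutation avoids a pattern $q$ if it has no subsequence order-isomorphic to $q$. $[x^k]F(x)$ denotes the coefficient of $x^k$ in the formal power series $F$. If for every $k\ge0$ there are constants $m_k,c_k(B)$ with $\mathrm{av}_n^k(B)=c_k(B)$ for all $n\ge m_k$, then $C_B(x)=\sum_{k\ge 0}c_k(B)x^k$ is the limit generating function of $B$. -}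

module Defs where

open import Data.Bool using (if_then_else_)
open import Data.Fin as Fin using (Fin; toℕ; #_)
import Data.Fin.Properties as Fin
open import Data.Integer as ℤ using (ℤ; +_; 0ℤ; 1ℤ)
import Data.Integer.Properties as ℤ
open import Data.List using (List; []; _∷_; allFin; cartesianProduct; cartesianProductWith; filter; length)
open import Data.List.Relation.Unary.All as All using (All)
open import Data.Nat as ℕ using (ℕ; zero; suc; _∸_)
open import Data.Product using (Σ; ∃; _×_; _,_; uncurry)
open import Data.Vec as Vec using (Vec; []; _∷_; lookup; head)
open import Data.Vec.Relation.Unary.AllPairs as AllPairs using (AllPairs; allPairs?)
open import Data.Vec.Relation.Unary.Unique.Propositional using (Unique)
open import Function using (_⇔_; mk⇔; Equivalence)
open import Relation.Binary.PropositionalEquality using (_≡_; refl)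
open import Relation.Nullary using (¬_; Dec; ¬?; _×-dec_; _→-dec_)
open import Relation.Nullary.Decidable using (map′)
open import Relation.Unary using (Decidable)
open import Algebra.Properties.CommutativeMonoid.Sum ℤ.+-0-commutativeMonoid using (sum)

-- A permutation of length n is written in one-line notation as a word of
-- length n in which no letter repeats; positions and letters are 0, …, n - 1.

Word : ℕ → ℕ → Set
Word n m = Vec (Fin n) m

words : ∀ n m → List (Word n m)
words n zero    = [] ∷ []
words n (suc m) = cartesianProductWith _∷_ (allFin n) (words n m)

unique? : ∀ {n m} → Decidable (Unique {A = Fin n} {m})
unique? = allPairs? (λ a b → ¬? (a Fin.≟ b))

S : ∀ n → List (Word n n)
S n = filter unique? (words n n)

inversions : ∀ {n} → Word n n → ℕ
inversions {n} π =
  length (filter (λ (i , j) → (i Fin.<? j) ×-dec (lookup π j Fin.<? lookup π i))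
                 (cartesianProduct (allFin n) (allFin n)))

OrderIsomorphic : ∀ {n n′ m} → Word n m → Word n′ m → Set
OrderIsomorphic u v = ∀ i j → (lookup u i Fin.< lookup u j) ⇔ (lookup v i Fin.< lookup v j)

Pattern : Set
Pattern = ∃ λ m → Word m m

-- The vector e lists the positions of a subsequence of π.

Contains : ∀ {n} → Word n n → Pattern → Set
Contains {n} π (m , q) =
  Σ (Vec (Fin n) m) λ e → AllPairs Fin._<_ e × OrderIsomorphic (Vec.map (lookup π) e) q

Avoids : ∀ {n} → Word n n → Pattern → Set
Avoids π q = ¬ Contains π q

orderIsomorphic? : ∀ {n n′ m} (u : Word n m) (v : Word n′ m) → Dec (OrderIsomorphic u v)
orderIsomorphic? u v = Fin.all? λ i → Fin.all? λ j →
  let a = lookup u i Fin.<? lookup u j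
      b = lookup v i Fin.<? lookup v j
  in map′ (uncurry mk⇔) (λ e → Equivalence.to e , Equivalence.from e)
          ((a →-dec b) ×-dec (b →-dec a))

anyWord? : ∀ {n} m {P : Word n m → Set} → Decidable P → Dec (∃ P)
anyWord? zero    P? = map′ ([] ,_) (λ { ([] , p) → p }) (P? [])
anyWord? (suc m) P? =
  map′ (λ (a , w , p) → a ∷ w , p) (λ { (a ∷ w , p) → a , w , p })
       (Fin.any? λ a → anyWord? m λ w → P? (a ∷ w))

contains? : ∀ {n} (π : Word n n) (q : Pattern) → Dec (Contains π q)
contains? π (m , q) = anyWord? m λ e →
  allPairs? Fin._<?_ e ×-dec orderIsomorphic? (Vec.map (lookup π) e) q

avoids? : ∀ {n} (π : Word n n) (q : Pattern) → Dec (Avoids π q)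
avoids? π q = ¬? (contains? π q)

av : (n k : ℕ) → List Pattern → ℕ
av n k B =
  length (filter (λ π → (inversions π ℕ.≟ k) ×-dec All.all? (avoids? π) B) (S n))

p1324 p1342 : Pattern
p1324 = 4 , # 0 ∷ # 2 ∷ # 1 ∷ # 3 ∷ []
p1342 = 4 , # 0 ∷ # 2 ∷ # 3 ∷ # 1 ∷ []

-- A formal power series over ℤ is its coefficient sequence, so [xᵏ] f is f k
-- and equality of series is pointwise equality _≗_.

PowerSeries : Set
PowerSeries = ℕ → ℤ

infixl 6 _⊕_ _⊖_
infixl 7 _⊛_

const : ℤ → PowerSeries
const c zero    = c
const c (suc _) = 0ℤ

X^_ : ℕ → PowerSeries
(X^ m) k = if k ℕ.≡ᵇ m then 1ℤ else 0ℤ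

_⊕_ _⊖_ _⊛_ : PowerSeries → PowerSeries → PowerSeries
(f ⊕ g) k = f k ℤ.+ g k
(f ⊖ g) k = f k ℤ.- g k
(f ⊛ g) k = sum λ (i : Fin (suc k)) → f (toℕ i) ℤ.* g (k ∸ toℕ i)

-- For g with constant term 1, the equation g h = 1 determines h by h₀ = 1 and
-- hₙ = - (g₁ hₙ₋₁ + ⋯ + gₙ h₀) for n ≥ 1.  The vector is hₙ, hₙ₋₁, …, h₀.

recipCoeffs : PowerSeries → ∀ n → Vec ℤ (suc n)
recipCoeffs g zero    = 1ℤ ∷ []
recipCoeffs g (suc n) =
  let hs = recipCoeffs g n
  in ℤ.- (sum λ i → g (suc (toℕ i)) ℤ.* lookup hs i) ∷ hs

recip : (g : PowerSeries) → g 0 ≡ 1ℤ → PowerSeries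
recip g _ n = head (recipCoeffs g n)

-- The partial product f 1 ⋯ f N.

partialProduct : (ℕ → PowerSeries) → ℕ → PowerSeries
partialProduct f zero    = const 1ℤ
partialProduct f (suc N) = partialProduct f N ⊛ f (suc N)

-- The infinite product over i ≥ 1, for factors with f i ≡ 1 (mod xⁱ): the
-- factors with i > k do not affect the coefficient of xᵏ.

infiniteProduct : (ℕ → PowerSeries) → PowerSeries
infiniteProduct f k = partialProduct f k k

-- (1 + xⁱ) / (1 - xⁱ).  At i = 0 the denominator is not invertible; the value
-- there is arbitrary, as the product starts at i = 1.

factor : ℕ → PowerSeries
factor zero      = const 1ℤ
factor i@(suc _) = (const 1ℤ ⊕ X^ i) ⊛ recip (const 1ℤ ⊖ X^ i) refl

∏[1+xⁱ]/[1-xⁱ] : PowerSeries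
∏[1+xⁱ]/[1-xⁱ] = infiniteProduct factor

1/[1-x] : PowerSeries
1/[1-x] = recip (const 1ℤ ⊖ X^ 1) refl

-- xⁿ⁻¹ (2 + 2x), for n ≥ 1.

xⁿ⁻¹[2+2x] : ℕ → PowerSeries
xⁿ⁻¹[2+2x] n = X^ (n ∸ 1) ⊛ (const (+ 2) ⊕ const (+ 2) ⊛ X^ 1)

IsLimitGF : List Pattern → PowerSeries → Set
IsLimitGF B C = ∀ k → ∃ λ mₖ → ∀ n → mₖ ℕ.≤ n → + av n k B ≡ C k

module Submission where

-- A permutation avoids 1324 and 1342 if and only if, for every letter, the
-- larger letters after it avoid 213 and 231.  Let Γ m t count, by inversions,
-- the avoiders of size m whose letters ≥ t avoid 213 and 231.  Such a
-- permutation v σ of size m + 1 has v ≤ t or v = m, and σ is then counted by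
-- Γ m (min v t), so that
--   Γ (m + 1) t = Σ_{v < m, v ≤ t} xᵛ Γ m v + xᵐ Γ m (min m t).
-- The columns t = 0 and t = 1 have product formulas.  By induction, for
-- 1 ≤ b ≤ m - 2, the series (1 - x) (∏_{i ≤ b} (1 - xⁱ)) Γ m b is congruent to
--   (∏_{i ≥ 1} (1 + xⁱ)) (1 - x - xᵐ - (xᵐ + xᵐ⁻¹) (1 - xᵇ))  modulo x²ᵐ⁻⁴.
-- Since all avoiders of size m are counted by Γ m m = Γ m (m - 2), this yields
-- the coefficients up to x²ᵐ⁻⁵.

open import Defs
open import Algebra.Bundles using (CommutativeRing)
import Algebra.Solver.Ring as RingSolver
open import Algebra.Solver.Ring.AlmostCommutativeRing using (fromCommutativeRing; _-Raw-AlmostCommutative⟶_)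
open import Data.Bool using (true; false)
open import Data.Empty using (⊥; ⊥-elim)
open import Data.Fin as Fin using (Fin; zero; suc; toℕ; punchIn; punchOut)
open import Data.Fin.Patterns using (0F; 1F; 2F; 3F)
import Data.Fin.Properties as Fin
open import Data.Integer as ℤ using (ℤ; +_; 0ℤ; 1ℤ; -1ℤ)
import Data.Integer.Properties as ℤ
import Data.Integer.Solver as ℤ
open import Data.List as List using (List; []; _∷_; _++_; allFin; cartesianProduct; cartesianProductWith; filter; length)
import Data.List.Properties as List
open import Data.List.Relation.Unary.All as All using (All; []; _∷_)
import Data.List.Relation.Unary.All.Properties as All
open import Data.Maybe using (Maybe)
open import Data.Nat as ℕ using (ℕ; zero; suc; _+_; _*_; _≤_; _<_; z≤n; s≤s; _∸_; _⊓_)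
open import Data.Nat.ListAction using () renaming (sum to sumℕ)
import Data.Nat.Properties as ℕ
import Data.Nat.Solver as ℕ
open import Data.Product as Product using (∃; _×_; _,_; proj₁; proj₂)
open import Data.Sum as Sum using (_⊎_; inj₁; inj₂)
open import Data.Vec as Vec using (Vec; []; _∷_; lookup)
open import Data.Vec.Membership.Propositional.Properties using (∈-lookup)
import Data.Vec.Properties as Vec
import Data.Vec.Relation.Unary.All as VecAll
open VecAll using ([]; _∷_)
open import Data.Vec.Relation.Unary.AllPairs as AllPairs using (AllPairs; []; _∷_)
import Data.Vec.Relation.Unary.AllPairs.Properties as AllPairs
open import Data.Vec.Relation.Unary.Unique.Propositional using (Unique)
open import Function using (_∘_; _⇔_; mk⇔; Equivalence)
open import Level using (0ℓ)
open import Relation.Binary using (tri<; tri≈; tri>)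
open import Relation.Binary.Bundles using (Setoid)
open import Relation.Binary.PropositionalEquality
import Relation.Binary.Reasoning.Setoid as SetoidReasoning
open import Relation.Nullary using (¬_; Dec; yes; no; does; _×-dec_; _⊎-dec_; _→-dec_; ¬?)
open import Relation.Nullary.Decidable using (dec⇒maybe; map′)
open import Relation.Unary using (Pred; Decidable)
open import Algebra.Properties.CommutativeMonoid.Sum ℤ.+-0-commutativeMonoid using (sum; sum-cong-≗)

open Equivalence using (to; from)

-- The ring of formal power series

-- Write P for the product of all `1 + xⁱ`, truncated at `N` in the code, with `j = m - 2` and
-- `c = b - 1`, so that `1 ≤ b ≤ m - 2` reads `c < j`. For large m neighbouring columns satisfy
-- `g_b = g_(b-1) + x^b g_b`. Multiplying column b by the factors `1 - xⁱ` with `i ≤ b`, and by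
-- `1 - x`, therefore gives all columns `b ≥ 1` the same limit `P (1 - x)`. The correction is found
-- by linearising the recurrence in `u = x^(m-2)`. A particular solution is `- x^m`, and every
-- multiple of `u (1 - x^b)` solves the homogeneous equation. The exactly known column 1 fixes the
-- multiple as `- (x^2 + x)`. The error is quadratic in u, whence the modulus `x^(2m-4)`. The
-- obstacle is the edge of the range: the step to size m + 1 at `b = m - 1` uses column `m - 1` of
-- size m, which lies outside it. There `Γ m (m - 1) = Γ m (m - 2)` still gives a congruence modulo
-- `x^(m-1)`. This suffices, because the recurrence multiplies that column by `x^b` or `x^m`.

shift : PowerSeries → PowerSeries
shift f = f ∘ suc

scale : ℤ → PowerSeries → PowerSeries
scale c f k = c ℤ.* f k

𝟘 : PowerSeries
𝟘 _ = 0ℤ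

⊝_ : PowerSeries → PowerSeries
(⊝ f) k = ℤ.- f k

infixl 7 _·_

-- Being opaque, _·_ does not unfold at a given coefficient, so that its
-- arguments can be inferred.
opaque
  _·_ : PowerSeries → PowerSeries → PowerSeries
  _·_ = _⊛_

  ·≡⊛ : ∀ f g → f · g ≡ f ⊛ g
  ·≡⊛ f g = refl

  ·-zero : ∀ f g → (f · g) 0 ≡ f 0 ℤ.* g 0
  ·-zero f g = ℤ.+-identityʳ _

  ·-suc : ∀ f g k → (f · g) (suc k) ≡ f 0 ℤ.* g (suc k) ℤ.+ (shift f · g) k
  ·-suc f g k = refl

-- A coefficient of a product depends only on coefficients of the factors up to the same degree.
-- This bounded form is what makes truncated congruences compatible with products in `≈-·`.
·-cong-≤ : ∀ {f f′ g g′} k → (∀ j → j ≤ k → f j ≡ f′ j) → (∀ j → j ≤ k → g j ≡ g′ j) →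
           (f · g) k ≡ (f′ · g′) k
·-cong-≤ {f} {f′} {g} {g′} zero p q = begin
  (f · g) 0         ≡⟨ ·-zero f g ⟩
  f 0 ℤ.* g 0       ≡⟨ cong₂ ℤ._*_ (p 0 z≤n) (q 0 z≤n) ⟩
  f′ 0 ℤ.* g′ 0     ≡⟨ ·-zero f′ g′ ⟨
  (f′ · g′) 0       ∎
  where open ≡-Reasoning
·-cong-≤ {f} {f′} {g} {g′} (suc k) p q = begin
  (f · g) (suc k)                                 ≡⟨ ·-suc f g k ⟩
  f 0 ℤ.* g (suc k) ℤ.+ (shift f · g) k           ≡⟨ cong₂ ℤ._+_ (cong₂ ℤ._*_ (p 0 z≤n) (q (suc k) ℕ.≤-refl))
                                                       (·-cong-≤ k (λ j j≤k → p (suc j) (s≤s j≤k))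
                                                                   (λ j j≤k → q j (ℕ.m≤n⇒m≤1+n j≤k))) ⟩
  f′ 0 ℤ.* g′ (suc k) ℤ.+ (shift f′ · g′) k       ≡⟨ ·-suc f′ g′ k ⟨
  (f′ · g′) (suc k)                               ∎
  where open ≡-Reasoning

·-cong : ∀ {f f′ g g′} → f ≗ f′ → g ≗ g′ → f · g ≗ f′ · g′
·-cong p q k = ·-cong-≤ k (λ j _ → p j) (λ j _ → q j)


·-distribˡ : ∀ f g h → f · (g ⊕ h) ≗ f · g ⊕ f · h
·-distribˡ f g h zero = begin
  (f · (g ⊕ h)) 0                ≡⟨ ·-zero f (g ⊕ h) ⟩
  f 0 ℤ.* (g 0 ℤ.+ h 0)          ≡⟨ ℤ.*-distribˡ-+ (f 0) (g 0) (h 0) ⟩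
  f 0 ℤ.* g 0 ℤ.+ f 0 ℤ.* h 0    ≡⟨ cong₂ ℤ._+_ (·-zero f g) (·-zero f h) ⟨
  (f · g ⊕ f · h) 0              ∎
  where open ≡-Reasoning
·-distribˡ f g h (suc k) = begin
  (f · (g ⊕ h)) (suc k)
    ≡⟨ ·-suc f (g ⊕ h) k ⟩
  f 0 ℤ.* (g (suc k) ℤ.+ h (suc k)) ℤ.+ (shift f · (g ⊕ h)) k
    ≡⟨ cong (λ a → f 0 ℤ.* (g (suc k) ℤ.+ h (suc k)) ℤ.+ a) (·-distribˡ (shift f) g h k) ⟩
  f 0 ℤ.* (g (suc k) ℤ.+ h (suc k)) ℤ.+ ((shift f · g) k ℤ.+ (shift f · h) k)
    ≡⟨ solve 5 (λ a b c d e → a :* (b :+ c) :+ (d :+ e) := (a :* b :+ d) :+ (a :* c :+ e)) refl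
         (f 0) (g (suc k)) (h (suc k)) ((shift f · g) k) ((shift f · h) k) ⟩
  (f 0 ℤ.* g (suc k) ℤ.+ (shift f · g) k) ℤ.+ (f 0 ℤ.* h (suc k) ℤ.+ (shift f · h) k)
    ≡⟨ cong₂ ℤ._+_ (·-suc f g k) (·-suc f h k) ⟨
  (f · g ⊕ f · h) (suc k) ∎
  where open ≡-Reasoning; open ℤ.+-*-Solver

-- The convolution recurses on its left factor only; peeling off the last summand instead supplies
-- the mirror image that commutativity needs.
·-snoc : ∀ f g k → (f · g) (suc k) ≡ (f · shift g) k ℤ.+ f (suc k) ℤ.* g 0
·-snoc f g zero = begin
  (f · g) 1                                     ≡⟨ ·-suc f g 0 ⟩
  f 0 ℤ.* g 1 ℤ.+ (shift f · g) 0               ≡⟨ cong₂ ℤ._+_ (sym (·-zero f (shift g))) (·-zero (shift f) g) ⟩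
  (f · shift g) 0 ℤ.+ f 1 ℤ.* g 0               ∎
  where open ≡-Reasoning
·-snoc f g (suc k) = begin
  (f · g) (suc (suc k))
    ≡⟨ ·-suc f g (suc k) ⟩
  f 0 ℤ.* g (suc (suc k)) ℤ.+ (shift f · g) (suc k)
    ≡⟨ cong (λ a → f 0 ℤ.* g (suc (suc k)) ℤ.+ a) (·-snoc (shift f) g k) ⟩
  f 0 ℤ.* g (suc (suc k)) ℤ.+ ((shift f · shift g) k ℤ.+ f (suc (suc k)) ℤ.* g 0)
    ≡⟨ ℤ.+-assoc (f 0 ℤ.* g (suc (suc k))) ((shift f · shift g) k) (f (suc (suc k)) ℤ.* g 0) ⟨
  f 0 ℤ.* g (suc (suc k)) ℤ.+ (shift f · shift g) k ℤ.+ f (suc (suc k)) ℤ.* g 0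
    ≡⟨ cong (λ a → a ℤ.+ f (suc (suc k)) ℤ.* g 0) (·-suc f (shift g) k) ⟨
  (f · shift g) (suc k) ℤ.+ f (suc (suc k)) ℤ.* g 0 ∎
  where open ≡-Reasoning

·-comm : ∀ f g → f · g ≗ g · f
·-comm f g zero = begin
  (f · g) 0      ≡⟨ ·-zero f g ⟩
  f 0 ℤ.* g 0    ≡⟨ ℤ.*-comm (f 0) (g 0) ⟩
  g 0 ℤ.* f 0    ≡⟨ ·-zero g f ⟨
  (g · f) 0      ∎
  where open ≡-Reasoning
·-comm f g (suc k) = begin
  (f · g) (suc k)                              ≡⟨ ·-suc f g k ⟩
  f 0 ℤ.* g (suc k) ℤ.+ (shift f · g) k        ≡⟨ cong₂ ℤ._+_ (ℤ.*-comm (f 0) (g (suc k))) (·-comm (shift f) g k) ⟩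
  g (suc k) ℤ.* f 0 ℤ.+ (g · shift f) k        ≡⟨ ℤ.+-comm (g (suc k) ℤ.* f 0) ((g · shift f) k) ⟩
  (g · shift f) k ℤ.+ g (suc k) ℤ.* f 0        ≡⟨ ·-snoc g f k ⟨
  (g · f) (suc k)                              ∎
  where open ≡-Reasoning

·-distribʳ : ∀ f g h → (g ⊕ h) · f ≗ g · f ⊕ h · f
·-distribʳ f g h k = begin
  ((g ⊕ h) · f) k          ≡⟨ ·-comm (g ⊕ h) f k ⟩
  (f · (g ⊕ h)) k          ≡⟨ ·-distribˡ f g h k ⟩
  (f · g) k ℤ.+ (f · h) k  ≡⟨ cong₂ ℤ._+_ (·-comm f g k) (·-comm f h k) ⟩
  (g · f ⊕ h · f) k        ∎
  where open ≡-Reasoning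

scale-· : ∀ c f g → scale c f · g ≗ scale c (f · g)
scale-· c f g zero = begin
  (scale c f · g) 0        ≡⟨ ·-zero (scale c f) g ⟩
  c ℤ.* f 0 ℤ.* g 0        ≡⟨ ℤ.*-assoc c (f 0) (g 0) ⟩
  c ℤ.* (f 0 ℤ.* g 0)      ≡⟨ cong (c ℤ.*_) (·-zero f g) ⟨
  scale c (f · g) 0        ∎
  where open ≡-Reasoning
scale-· c f g (suc k) = begin
  (scale c f · g) (suc k)
    ≡⟨ ·-suc (scale c f) g k ⟩
  c ℤ.* f 0 ℤ.* g (suc k) ℤ.+ (scale c (shift f) · g) k
    ≡⟨ cong (λ a → c ℤ.* f 0 ℤ.* g (suc k) ℤ.+ a) (scale-· c (shift f) g k) ⟩
  c ℤ.* f 0 ℤ.* g (suc k) ℤ.+ c ℤ.* (shift f · g) k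
    ≡⟨ solve 4 (λ c a b d → c :* a :* b :+ c :* d := c :* (a :* b :+ d)) refl
         c (f 0) (g (suc k)) ((shift f · g) k) ⟩
  c ℤ.* (f 0 ℤ.* g (suc k) ℤ.+ (shift f · g) k)
    ≡⟨ cong (c ℤ.*_) (·-suc f g k) ⟨
  scale c (f · g) (suc k) ∎
  where open ≡-Reasoning; open ℤ.+-*-Solver

𝟘-· : ∀ f → 𝟘 · f ≗ 𝟘
𝟘-· f k = trans (scale-· 0ℤ 𝟘 f k) (ℤ.*-zeroˡ ((𝟘 · f) k))

const-· : ∀ c f → const c · f ≗ scale c f
const-· c f zero    = ·-zero (const c) f
const-· c f (suc k) = begin
  (const c · f) (suc k)            ≡⟨ ·-suc (const c) f k ⟩
  c ℤ.* f (suc k) ℤ.+ (𝟘 · f) k    ≡⟨ cong (λ a → c ℤ.* f (suc k) ℤ.+ a) (𝟘-· f k) ⟩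
  c ℤ.* f (suc k) ℤ.+ 0ℤ           ≡⟨ ℤ.+-identityʳ _ ⟩
  scale c f (suc k)                ∎
  where open ≡-Reasoning

·-identityˡ : ∀ f → const 1ℤ · f ≗ f
·-identityˡ f k = trans (const-· 1ℤ f k) (ℤ.*-identityˡ (f k))

·-assoc : ∀ f g h → (f · g) · h ≗ f · (g · h)
·-assoc f g h zero = begin
  ((f · g) · h) 0           ≡⟨ ·-zero (f · g) h ⟩
  (f · g) 0 ℤ.* h 0         ≡⟨ cong (ℤ._* h 0) (·-zero f g) ⟩
  f 0 ℤ.* g 0 ℤ.* h 0       ≡⟨ ℤ.*-assoc (f 0) (g 0) (h 0) ⟩
  f 0 ℤ.* (g 0 ℤ.* h 0)     ≡⟨ cong (f 0 ℤ.*_) (·-zero g h) ⟨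
  f 0 ℤ.* (g · h) 0         ≡⟨ ·-zero f (g · h) ⟨
  (f · (g · h)) 0           ∎
  where open ≡-Reasoning
·-assoc f g h (suc k) = begin
  ((f · g) · h) (suc k)
    ≡⟨ ·-suc (f · g) h k ⟩
  (f · g) 0 ℤ.* h (suc k) ℤ.+ (shift (f · g) · h) k
    -- `·-suc` read as an equation of series: `shift (f · g)` is `f 0` times `shift g` plus
    -- `shift f · g`.
    ≡⟨ cong₂ (λ a b → a ℤ.* h (suc k) ℤ.+ b) (·-zero f g) (·-cong (·-suc f g) (λ _ → refl) k) ⟩
  f 0 ℤ.* g 0 ℤ.* h (suc k) ℤ.+ ((scale (f 0) (shift g) ⊕ shift f · g) · h) k
    ≡⟨ cong (λ a → f 0 ℤ.* g 0 ℤ.* h (suc k) ℤ.+ a) (·-distribʳ h (scale (f 0) (shift g)) (shift f · g) k) ⟩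
  f 0 ℤ.* g 0 ℤ.* h (suc k) ℤ.+ ((scale (f 0) (shift g) · h) k ℤ.+ ((shift f · g) · h) k)
    ≡⟨ cong₂ (λ a b → f 0 ℤ.* g 0 ℤ.* h (suc k) ℤ.+ (a ℤ.+ b))
         (scale-· (f 0) (shift g) h k) (·-assoc (shift f) g h k) ⟩
  f 0 ℤ.* g 0 ℤ.* h (suc k) ℤ.+ (f 0 ℤ.* (shift g · h) k ℤ.+ (shift f · (g · h)) k)
    ≡⟨ solve 5 (λ a b c d e → a :* b :* c :+ (a :* d :+ e) := a :* (b :* c :+ d) :+ e) refl
         (f 0) (g 0) (h (suc k)) ((shift g · h) k) ((shift f · (g · h)) k) ⟩
  f 0 ℤ.* (g 0 ℤ.* h (suc k) ℤ.+ (shift g · h) k) ℤ.+ (shift f · (g · h)) k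
    ≡⟨ cong (λ a → f 0 ℤ.* a ℤ.+ (shift f · (g · h)) k) (·-suc g h k) ⟨
  f 0 ℤ.* (g · h) (suc k) ℤ.+ (shift f · (g · h)) k
    ≡⟨ ·-suc f (g · h) k ⟨
  (f · (g · h)) (suc k) ∎
  where open ≡-Reasoning; open ℤ.+-*-Solver

const-* : ∀ a b → const (a ℤ.* b) ≗ const a · const b
const-* a b zero    = sym (·-zero (const a) (const b))
const-* a b (suc k) = sym (trans (const-· a (const b) (suc k)) (ℤ.*-zeroʳ a))

seriesRing : CommutativeRing 0ℓ 0ℓ
seriesRing = record
  { Carrier = PowerSeries
  ; _≈_     = _≗_
  ; _+_     = _⊕_
  ; _*_     = _·_
  ; -_      = ⊝_
  ; 0#      = 𝟘
  ; 1#      = const 1ℤ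
  ; isCommutativeRing = record
    { isRing = record
      { +-isAbelianGroup = record
        { isGroup = record
          { isMonoid = record
            { isSemigroup = record
              { isMagma = record
                { isEquivalence = record
                  { refl  = λ _ → refl
                  ; sym   = λ p k → sym (p k)
                  ; trans = λ p q k → trans (p k) (q k)
                  }
                ; ∙-cong = λ p q k → cong₂ ℤ._+_ (p k) (q k)
                }
              ; assoc = λ f g h k → ℤ.+-assoc (f k) (g k) (h k)
              }
            ; identity = (λ f k → ℤ.+-identityˡ (f k)) , (λ f k → ℤ.+-identityʳ (f k))
            }
          ; inverse = (λ f k → ℤ.+-inverseˡ (f k)) , (λ f k → ℤ.+-inverseʳ (f k))
          ; ⁻¹-cong = λ p k → cong ℤ.-_ (p k)
          }
        ; comm = λ f g k → ℤ.+-comm (f k) (g k)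
        }
      ; *-cong = ·-cong
      ; *-assoc = ·-assoc
      ; *-identity = ·-identityˡ , λ f k → trans (·-comm f (const 1ℤ) k) (·-identityˡ f k)
      ; distrib = ·-distribˡ , ·-distribʳ
      }
    ; *-comm = ·-comm
    }
  }

-- Lets the ring solver compute with integer coefficients embedded as constant series.
const-homomorphism : CommutativeRing.rawRing ℤ.+-*-commutativeRing
                       -Raw-AlmostCommutative⟶ fromCommutativeRing seriesRing
const-homomorphism = record
  { ⟦_⟧    = const
  ; +-homo = λ { a b zero → refl ; a b (suc k) → refl }
  ; *-homo = const-*
  ; -‿homo = λ { a zero → refl ; a (suc k) → refl }
  ; 0-homo = λ { zero → refl ; (suc k) → refl }
  ; 1-homo = λ _ → refl
  }

const-≟ : ∀ a b → Maybe (const a ≗ const b)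
const-≟ a b = dec⇒maybe (map′ (λ { refl _ → refl }) (λ p → p 0) (a ℤ.≟ b))

module SeriesSolver = RingSolver _ (fromCommutativeRing seriesRing) const-homomorphism const-≟

open SeriesSolver using (solve; _:=_; _:+_; _:*_; _:-_; con)
open ℕ.+-*-Solver using () renaming (solve to solveℕ; _:=_ to _=ℕ_; _:+_ to _+ℕ_; _:*_ to _*ℕ_; con to conℕ)
open CommutativeRing seriesRing using ()
  renaming (setoid to seriesSetoid; refl to ≗-refl; sym to ≗-sym; trans to ≗-trans; +-cong to ⊕-cong)

·-congˡ : ∀ f {g h} → g ≗ h → f · g ≗ f · h
·-congˡ f = ·-cong (λ _ → refl)

·-congʳ : ∀ f {g h} → g ≗ h → g · f ≗ h · f
·-congʳ f p = ·-cong p (λ _ → refl)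

⊖-cong : ∀ {f f′ g g′} → f ≗ f′ → g ≗ g′ → f ⊖ g ≗ f′ ⊖ g′
⊖-cong p q k = cong₂ ℤ._-_ (p k) (q k)

⊕-congˡ : ∀ f {g h} → g ≗ h → f ⊕ g ≗ f ⊕ h
⊕-congˡ f p k = cong (λ a → f k ℤ.+ a) (p k)

⊖-congˡ : ∀ f {g h} → g ≗ h → f ⊖ g ≗ f ⊖ h
⊖-congˡ f p k = cong (λ a → f k ℤ.- a) (p k)

X^0 : X^ 0 ≗ const 1ℤ
X^0 zero    = refl
X^0 (suc k) = refl

X^suc-·-suc : ∀ m f k → (X^ (suc m) · f) (suc k) ≡ (X^ m · f) k
X^suc-·-suc m f k = trans (·-suc (X^ (suc m)) f k) (ℤ.+-identityˡ _)

X^-· : ∀ m f k → (X^ m · f) (m + k) ≡ f k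
X^-· zero    f k = trans (·-congʳ f X^0 k) (·-identityˡ f k)
X^-· (suc m) f k = trans (X^suc-·-suc m f (m + k)) (X^-· m f k)

X^-·-< : ∀ m f {k} → k < m → (X^ m · f) k ≡ 0ℤ
X^-·-< (suc m) f {zero}  _         = ·-zero (X^ (suc m)) f
X^-·-< (suc m) f {suc k} (s≤s k<m) = trans (X^suc-·-suc m f k) (X^-·-< m f k<m)

X^-+ : ∀ m n → X^ (m + n) ≗ X^ m · X^ n
X^-+ zero    n k       = sym (trans (·-congʳ (X^ n) X^0 k) (·-identityˡ (X^ n) k))
X^-+ (suc m) n zero    = sym (·-zero (X^ (suc m)) (X^ n))
X^-+ (suc m) n (suc k) = trans (X^-+ m n k) (sym (X^suc-·-suc m (X^ n) k))

-- Congruence of series modulo a power of x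

infix 4 _≈[_]_

_≈[_]_ : PowerSeries → ℕ → PowerSeries → Set
f ≈[ N ] g = ∀ k → k < N → f k ≡ g k

modSetoid : ℕ → Setoid 0ℓ 0ℓ
modSetoid N = record
  { Carrier       = PowerSeries
  ; _≈_           = _≈[ N ]_
  ; isEquivalence = record
    { refl  = λ _ _ → refl
    ; sym   = λ p k k<N → sym (p k k<N)
    ; trans = λ p q k k<N → trans (p k k<N) (q k k<N)
    }
  }

≗⇒≈ : ∀ {N f g} → f ≗ g → f ≈[ N ] g
≗⇒≈ p k _ = p k

≈-weaken : ∀ {M N f g} → N ≤ M → f ≈[ M ] g → f ≈[ N ] g
≈-weaken N≤M p k k<N = p k (ℕ.<-≤-trans k<N N≤M)

≈-⊕ : ∀ {N f f′ g g′} → f ≈[ N ] f′ → g ≈[ N ] g′ → f ⊕ g ≈[ N ] f′ ⊕ g′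
≈-⊕ p q k k<N = cong₂ ℤ._+_ (p k k<N) (q k k<N)

≈-⊖ : ∀ {N f f′ g g′} → f ≈[ N ] f′ → g ≈[ N ] g′ → f ⊖ g ≈[ N ] f′ ⊖ g′
≈-⊖ p q k k<N = cong₂ ℤ._-_ (p k k<N) (q k k<N)

≈-· : ∀ {N f f′ g g′} → f ≈[ N ] f′ → g ≈[ N ] g′ → f · g ≈[ N ] f′ · g′
≈-· p q k k<N =
  ·-cong-≤ k (λ j j≤k → p j (ℕ.≤-<-trans j≤k k<N)) (λ j j≤k → q j (ℕ.≤-<-trans j≤k k<N))

≈-·ˡ : ∀ f {N g h} → g ≈[ N ] h → f · g ≈[ N ] f · h
≈-·ˡ f = ≈-· (λ _ _ → refl)

≈-·ʳ : ∀ f {N g h} → g ≈[ N ] h → g · f ≈[ N ] h · f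
≈-·ʳ f p = ≈-· p (λ _ _ → refl)

-- A factor `X^ m` gains `m` orders of precision, which is how a weak congruence can enter a
-- stronger one.
≈-X^ : ∀ m {N f g} → f ≈[ N ] g → X^ m · f ≈[ m + N ] X^ m · g
≈-X^ zero    {f = f} {g} p k k<N = ≈-·ˡ (X^ 0) p k k<N
≈-X^ (suc m) {f = f} {g} p zero    _         = trans (·-zero (X^ (suc m)) f) (sym (·-zero (X^ (suc m)) g))
≈-X^ (suc m) {f = f} {g} p (suc k) (s≤s k<N) =
  trans (X^suc-·-suc m f k) (trans (≈-X^ m p k k<N) (sym (X^suc-·-suc m g k)))

-- Turns an exact polynomial identity with an explicit remainder, as the solver proves it, into a
-- congruence.
≈-absorb : ∀ {N m f g} r → N ≤ m → f ≗ g ⊕ X^ m · r → f ≈[ N ] g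
≈-absorb {N} {m} {f} {g} r N≤m p k k<N = begin
  f k                   ≡⟨ p k ⟩
  g k ℤ.+ (X^ m · r) k  ≡⟨ cong (λ a → g k ℤ.+ a) (X^-·-< m r (ℕ.<-≤-trans k<N N≤m)) ⟩
  g k ℤ.+ 0ℤ            ≡⟨ ℤ.+-identityʳ (g k) ⟩
  g k                   ∎
  where open ≡-Reasoning

≈-cancel : ∀ {N f g h} r → f · r ≗ const 1ℤ → f · g ≈[ N ] f · h → g ≈[ N ] h
≈-cancel {N} {f} {g} {h} r fr≗1 p = begin
  g              ≈⟨ ≗⇒≈ (λ k → sym (rearrange g k)) ⟩
  r · (f · g)    ≈⟨ ≈-·ˡ r p ⟩
  r · (f · h)    ≈⟨ ≗⇒≈ (rearrange h) ⟩
  h              ∎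
  where
  open SetoidReasoning (modSetoid N)
  rearrange : ∀ a → r · (f · a) ≗ a
  rearrange a k = trans (solve 3 (λ r f a → r :* (f :* a) := f :* r :* a) (λ _ → refl) r f a k)
                        (trans (·-congʳ a fr≗1 k) (·-identityˡ a k))

-- Reciprocals

lookup-recipCoeffs : ∀ g p n (i : Fin (suc n)) → lookup (recipCoeffs g n) i ≡ recip g p (n ∸ toℕ i)
lookup-recipCoeffs g p zero    Fin.zero    = refl
lookup-recipCoeffs g p (suc n) Fin.zero    = refl
lookup-recipCoeffs g p (suc n) (Fin.suc i) = lookup-recipCoeffs g p n i

·-recip : ∀ g (p : g 0 ≡ 1ℤ) → g · recip g p ≗ const 1ℤ
·-recip g p zero    = trans (·-zero g (recip g p)) (trans (ℤ.*-identityʳ (g 0)) p)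
·-recip g p (suc n) = begin
  (g · recip g p) (suc n)
    ≡⟨ ·-suc g (recip g p) n ⟩
  g 0 ℤ.* recip g p (suc n) ℤ.+ (shift g · recip g p) n
    ≡⟨ cong₂ ℤ._+_ (trans (cong (ℤ._* recip g p (suc n)) p) (ℤ.*-identityˡ (recip g p (suc n))))
                   (trans (cong-app (·≡⊛ (shift g) (recip g p)) n)
                          (sum-cong-≗ {suc n} (λ i → cong (g (suc (toℕ i)) ℤ.*_) (sym (lookup-recipCoeffs g p n i))))) ⟩
  ℤ.- tail ℤ.+ tail
    ≡⟨ ℤ.+-inverseˡ tail ⟩
  0ℤ ∎
  where
  open ≡-Reasoning
  tail = sum λ i → g (suc (toℕ i)) ℤ.* lookup (recipCoeffs g n) i

-- Finite products of factors `1 + ε xⁱ` and their tails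

x 1-x : PowerSeries
x   = X^ 1
1-x = const 1ℤ ⊖ x

-- With `ε` equal to 1 and -1 this gives numerators and denominators, so that one tail lemma serves
-- both.
Π : ℤ → ℕ → PowerSeries
Π ε zero    = const 1ℤ
Π ε (suc n) = Π ε n · (const 1ℤ ⊕ const ε · X^ (suc n))

X^-suc : ∀ n → X^ (suc n) ≗ x · X^ n
X^-suc n = X^-+ 1 n

-- Modulo x²ʲ, the tail ∏_{i > j} (1 + ε xⁱ) is 1 + ε xʲ⁺¹ / (1 - x), and its
-- inverse is 1 - ε xʲ⁺¹ / (1 - x).
Π-tail-step : ∀ ε j d →
  Π ε (d + j) · (1-x ⊖ const ε · (X^ (suc j) ⊖ X^ (suc (d + j)))) ≈[ j + j ] 1-x · Π ε j
Π-tail-step ε j zero = ≗⇒≈ (solve 4 (λ e x P u → P :* (con 1ℤ :- x :- e :* (u :- u)) := (con 1ℤ :- x) :* P)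
  (λ _ → refl) (const ε) x (Π ε j) (X^ (suc j)))
Π-tail-step ε j (suc d) = begin
  Π ε (suc d + j) · (1-x ⊖ const ε · (X^ (suc j) ⊖ X^ (suc (suc d + j))))
    -- The difference of powers is `1 - x` times the sum of `xⁱ` for `j < i ≤ d + j`. The terms
    -- linear in `e` contributed by the new factor cancel its last summand; what remains has `e · e`
    -- and `u · u` in it and is collected in `r`.
    ≈⟨ ≈-absorb _ (ℕ.≤-refl {j + j}) (λ k → trans (to-vars k) (trans (identity k) (sym (from-vars k)))) ⟩
  Π ε (d + j) · (1-x ⊖ const ε · (X^ (suc j) ⊖ X^ (suc (d + j))))
    ≈⟨ Π-tail-step ε j d ⟩
  1-x · Π ε j ∎
  where
  open SetoidReasoning (modSetoid (j + j))
  e = const ε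
  P = Π ε (d + j)
  u = X^ j
  z = X^ d
  w≗ : X^ (suc (d + j)) ≗ x · (z · u)
  w≗ k = trans (X^-suc (d + j) k) (·-congˡ x (X^-+ d j) k)
  xw≗ : X^ (suc (suc d + j)) ≗ x · (x · (z · u))
  xw≗ k = trans (X^-suc (suc d + j) k) (·-congˡ x w≗ k)
  r : PowerSeries
  r = P · e · e · x · z · (x · (x · z) ⊖ x)
  to-vars : Π ε (suc d + j) · (1-x ⊖ e · (X^ (suc j) ⊖ X^ (suc (suc d + j)))) ≗
            P · (const 1ℤ ⊕ e · (x · (z · u))) · (1-x ⊖ e · (x · u ⊖ x · (x · (z · u))))
  to-vars = ·-cong (·-congˡ P (⊕-congˡ (const 1ℤ) (·-congˡ e w≗)))
                   (⊖-congˡ 1-x (·-congˡ e (⊖-cong (X^-suc j) xw≗)))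
  identity : P · (const 1ℤ ⊕ e · (x · (z · u))) · (1-x ⊖ e · (x · u ⊖ x · (x · (z · u)))) ≗
             P · (1-x ⊖ e · (x · u ⊖ x · (z · u))) ⊕ u · u · r
  identity = solve 5 (λ e x P u z →
      P :* (con 1ℤ :+ e :* (x :* (z :* u))) :* (con 1ℤ :- x :- e :* (x :* u :- x :* (x :* (z :* u)))) :=
      P :* (con 1ℤ :- x :- e :* (x :* u :- x :* (z :* u))) :+ u :* u :* (P :* e :* e :* x :* z :* (x :* (x :* z) :- x)))
    (λ _ → refl) e x P u z
  from-vars : P · (1-x ⊖ e · (X^ (suc j) ⊖ X^ (suc (d + j)))) ⊕ X^ (j + j) · r ≗
              P · (1-x ⊖ e · (x · u ⊖ x · (z · u))) ⊕ u · u · r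
  from-vars = ⊕-cong (·-congˡ P (⊖-congˡ 1-x (·-congˡ e (⊖-cong (X^-suc j) w≗))))
                     (·-congʳ r (X^-+ j j))

-- Solution of the recurrence modulo a power of x

sumTo : (ℕ → PowerSeries) → ℕ → PowerSeries
sumTo f zero    = f 0
sumTo f (suc t) = sumTo f t ⊕ f (suc t)

-- The analysis uses nothing about permutations beyond these three equations. The two cases of the
-- recurrence resolve the minimum of `m` and `t`.
module Recurrence
  (Γ : ℕ → ℕ → PowerSeries)
  (Γ-zero : Γ 0 0 ≗ const 1ℤ)
  (Γ-suc-< : ∀ {m t} → t < m → Γ (suc m) t ≗ sumTo (λ v → X^ v · Γ m v) t ⊕ X^ m · Γ m t)
  (Γ-suc-≥ : ∀ {m t} → m ≤ t → Γ (suc m) t ≗ sumTo (λ v → X^ v · Γ m v) m)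
  where

  term : ℕ → ℕ → PowerSeries
  term m v = X^ v · Γ m v

  -- Subtracting neighbouring columns leaves a single term of the sum, so the recurrence acquires
  -- bounded length. The bound on `t` keeps both columns in the case `Γ-suc-<`.
  Γ-step : ∀ {m t} → suc t < m →
    Γ (suc m) (suc t) ≗ Γ (suc m) t ⊕ X^ (suc t) · Γ m (suc t) ⊕ X^ m · (Γ m (suc t) ⊖ Γ m t)
  Γ-step {m} {t} t+1<m = begin
    Γ (suc m) (suc t)
      ≈⟨ Γ-suc-< t+1<m ⟩
    sumTo (term m) t ⊕ term m (suc t) ⊕ X^ m · Γ m (suc t)
      ≈⟨ solve 5 (λ S a g h w → S :+ a :+ w :* h := S :+ w :* g :+ a :+ w :* (h :- g)) (λ _ → refl)
           (sumTo (term m) t) (term m (suc t)) (Γ m t) (Γ m (suc t)) (X^ m) ⟩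
    sumTo (term m) t ⊕ X^ m · Γ m t ⊕ term m (suc t) ⊕ X^ m · (Γ m (suc t) ⊖ Γ m t)
      ≈⟨ ⊕-cong (⊕-cong (≗-sym (Γ-suc-< (ℕ.<-trans ℕ.≤-refl t+1<m))) ≗-refl) ≗-refl ⟩
    Γ (suc m) t ⊕ term m (suc t) ⊕ X^ m · (Γ m (suc t) ⊖ Γ m t) ∎
    where open SetoidReasoning seriesSetoid

  -- Together with `Γ-subdiagonal` this reflects that two letters cannot contain 213 or 231: in size
  -- m the thresholds `m - 2`, `m - 1` and `m` impose no condition.
  Γ-diagonal : ∀ m → Γ (suc m) (suc m) ≗ Γ (suc m) m
  Γ-diagonal m = ≗-trans (Γ-suc-≥ (ℕ.n≤1+n m)) (≗-sym (Γ-suc-≥ ℕ.≤-refl))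

  Γ-subdiagonal : ∀ m → Γ (2 + m) (1 + m) ≗ Γ (2 + m) m
  Γ-subdiagonal m = begin
    Γ (2 + m) (1 + m)                                           ≈⟨ Γ-suc-≥ ℕ.≤-refl ⟩
    sumTo (term (1 + m)) m ⊕ X^ (1 + m) · Γ (1 + m) (1 + m)     ≈⟨ ⊕-congˡ (sumTo (term (1 + m)) m) (·-congˡ (X^ (1 + m)) (Γ-diagonal m)) ⟩
    sumTo (term (1 + m)) m ⊕ X^ (1 + m) · Γ (1 + m) m           ≈⟨ Γ-suc-< ℕ.≤-refl ⟨
    Γ (2 + m) m                                                 ∎
    where open SetoidReasoning seriesSetoid

  X^0-· : ∀ f → X^ 0 · f ≗ f
  X^0-· f = ≗-trans (·-congʳ f X^0) (·-identityˡ f)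

  Γ-1-0 : Γ 1 0 ≗ const 1ℤ
  Γ-1-0 = ≗-trans (Γ-suc-≥ z≤n) (≗-trans (X^0-· (Γ 0 0)) Γ-zero)

  -- In a permutation avoiding 213 and 231 each letter is the least or the greatest of those still
  -- to come, which contributes 1 or a power of x.
  Γ-column₀ : ∀ m → Γ (suc m) 0 ≗ Π 1ℤ m
  Γ-column₀ zero    = Γ-1-0
  Γ-column₀ (suc m) = begin
    Γ (2 + m) 0
      ≈⟨ Γ-suc-< (s≤s z≤n) ⟩
    X^ 0 · Γ (suc m) 0 ⊕ X^ (suc m) · Γ (suc m) 0
      ≈⟨ ⊕-cong (X^0-· (Γ (suc m) 0)) ≗-refl ⟩
    Γ (suc m) 0 ⊕ X^ (suc m) · Γ (suc m) 0
      ≈⟨ solve 2 (λ g w → g :+ w :* g := g :* (con 1ℤ :+ con 1ℤ :* w)) (λ _ → refl) (Γ (suc m) 0) (X^ (suc m)) ⟩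
    Γ (suc m) 0 · (const 1ℤ ⊕ const 1ℤ · X^ (suc m))
      ≈⟨ ·-congʳ (const 1ℤ ⊕ const 1ℤ · X^ (suc m)) (Γ-column₀ m) ⟩
    Π 1ℤ (suc m) ∎
    where open SetoidReasoning seriesSetoid

  -- Both terms with column 1 together carry `x (1 + xᵐ⁺¹)`, and column 0 grows by the same factor
  -- `1 + xᵐ⁺¹`. Once it is pulled out, `(1 - x) + x (1 - xᵐ⁺²)` collapses to `1 - xᵐ⁺³`.
  Γ-column₁ : ∀ m → 1-x · Γ (2 + m) 1 ≗ Π 1ℤ m · (const 1ℤ ⊖ x · (x · X^ m))
  Γ-column₁ zero = begin
    1-x · Γ 2 1
      ≈⟨ ·-congˡ 1-x (Γ-suc-≥ ℕ.≤-refl) ⟩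
    1-x · (X^ 0 · Γ 1 0 ⊕ x · Γ 1 1)
      ≈⟨ ·-congˡ 1-x (⊕-cong (≗-trans (X^0-· (Γ 1 0)) Γ-1-0) (·-congˡ x (≗-trans (Γ-diagonal 0) Γ-1-0))) ⟩
    1-x · (const 1ℤ ⊕ x · const 1ℤ)
      ≈⟨ solve 1 (λ x → (con 1ℤ :- x) :* (con 1ℤ :+ x :* con 1ℤ) := con 1ℤ :* (con 1ℤ :- x :* (x :* con 1ℤ)))
           (λ _ → refl) x ⟩
    const 1ℤ · (const 1ℤ ⊖ x · (x · const 1ℤ))
      ≈⟨ ·-congˡ (const 1ℤ) (⊖-congˡ (const 1ℤ) (·-congˡ x (·-congˡ x (≗-sym X^0)))) ⟩
    const 1ℤ · (const 1ℤ ⊖ x · (x · X^ 0)) ∎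
    where open SetoidReasoning seriesSetoid
  Γ-column₁ (suc m) = begin
    1-x · Γ (3 + m) 1
      ≈⟨ ·-congˡ 1-x (Γ-suc-< (s≤s (s≤s z≤n))) ⟩
    1-x · (X^ 0 · Γ (2 + m) 0 ⊕ x · Γ (2 + m) 1 ⊕ X^ (2 + m) · Γ (2 + m) 1)
      ≈⟨ ·-congˡ 1-x (⊕-cong (⊕-cong (≗-trans (X^0-· (Γ (2 + m) 0)) (Γ-column₀ (suc m))) ≗-refl)
                             (·-congʳ (Γ (2 + m) 1) (≗-trans (X^-suc (suc m)) (·-congˡ x (X^-suc m))))) ⟩
    1-x · (Π 1ℤ m · (const 1ℤ ⊕ const 1ℤ · X^ (suc m)) ⊕ x · Γ (2 + m) 1 ⊕ x · (x · u) · Γ (2 + m) 1)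
      ≈⟨ ·-congˡ 1-x (⊕-cong (⊕-cong (·-congˡ (Π 1ℤ m) (⊕-congˡ (const 1ℤ) (·-congˡ (const 1ℤ) (X^-suc m)))) ≗-refl) ≗-refl) ⟩
    1-x · (Π 1ℤ m · (const 1ℤ ⊕ const 1ℤ · (x · u)) ⊕ x · Γ (2 + m) 1 ⊕ x · (x · u) · Γ (2 + m) 1)
      ≈⟨ solve 4 (λ x u P g →
           (con 1ℤ :- x) :* (P :* (con 1ℤ :+ con 1ℤ :* (x :* u)) :+ x :* g :+ x :* (x :* u) :* g) :=
           (con 1ℤ :+ x :* u) :* ((con 1ℤ :- x) :* P :+ x :* ((con 1ℤ :- x) :* g)))
           (λ _ → refl) x u (Π 1ℤ m) (Γ (2 + m) 1) ⟩
    (const 1ℤ ⊕ x · u) · (1-x · Π 1ℤ m ⊕ x · (1-x · Γ (2 + m) 1))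
      ≈⟨ ·-congˡ (const 1ℤ ⊕ x · u) (⊕-congˡ (1-x · Π 1ℤ m) (·-congˡ x (Γ-column₁ m))) ⟩
    (const 1ℤ ⊕ x · u) · (1-x · Π 1ℤ m ⊕ x · (Π 1ℤ m · (const 1ℤ ⊖ x · (x · u))))
      ≈⟨ solve 3 (λ x u P →
           (con 1ℤ :+ x :* u) :* ((con 1ℤ :- x) :* P :+ x :* (P :* (con 1ℤ :- x :* (x :* u)))) :=
           P :* (con 1ℤ :+ con 1ℤ :* (x :* u)) :* (con 1ℤ :- x :* (x :* (x :* u))))
           (λ _ → refl) x u (Π 1ℤ m) ⟩
    Π 1ℤ m · (const 1ℤ ⊕ const 1ℤ · (x · u)) · (const 1ℤ ⊖ x · (x · (x · u)))
      ≈⟨ ·-cong (·-congˡ (Π 1ℤ m) (⊕-congˡ (const 1ℤ) (·-congˡ (const 1ℤ) (≗-sym (X^-suc m)))))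
                (⊖-congˡ (const 1ℤ) (·-congˡ x (·-congˡ x (≗-sym (X^-suc m))))) ⟩
    Π 1ℤ (suc m) · (const 1ℤ ⊖ x · (x · X^ (suc m))) ∎
    where
    open SetoidReasoning seriesSetoid
    u = X^ m

  y : ℕ → ℕ → PowerSeries
  y m b = 1-x · (Π -1ℤ b · Γ m b)

  module _ (N : ℕ) where

    -- The value of y m b up to x²ᵐ⁻⁴, as a function of u = xᵐ⁻² and s = xᵇ⁻¹.
    Y : PowerSeries → PowerSeries → PowerSeries
    Y u s = Π 1ℤ N · (1-x ⊖ x · (x · u) ⊖ (x · (x · u) ⊕ x · u) · (const 1ℤ ⊖ x · s))

    Y-cong : ∀ {u u′ s s′} → u ≗ u′ → s ≗ s′ → Y u s ≗ Y u′ s′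
    Y-cong p q = ·-congˡ (Π 1ℤ N)
      (⊖-cong (⊖-cong {1-x} ≗-refl (·-congˡ x (·-congˡ x p)))
              (·-cong (⊕-cong (·-congˡ x (·-congˡ x p)) (·-congˡ x p)) (⊖-congˡ (const 1ℤ) (·-congˡ x q))))

    Π-tail : ∀ ε {j} → j + j ≤ N → Π ε N · (1-x ⊖ const ε · X^ (suc j)) ≈[ j + j ] 1-x · Π ε j
    Π-tail ε {j} 2j≤N = begin
      Π ε N · (1-x ⊖ const ε · X^ (suc j))
        -- The end term `x^(N+1)` of the finite geometric sum is invisible modulo `x^(2j)`, since
        -- `2j ≤ N`.
        ≈⟨ ≈-absorb (⊝ (Π ε N · const ε)) (ℕ.m≤n⇒m≤1+n 2j≤N)
             (solve 5 (λ P e x a b → P :* (con 1ℤ :- x :- e :* a) :=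
                        P :* (con 1ℤ :- x :- e :* (a :- b)) :+ b :* SeriesSolver.:- (P :* e))
                (λ _ → refl) (Π ε N) (const ε) x (X^ (suc j)) (X^ (suc N))) ⟩
      Π ε N · (1-x ⊖ const ε · (X^ (suc j) ⊖ X^ (suc N)))
        ≡⟨ cong (λ n → Π ε n · (1-x ⊖ const ε · (X^ (suc j) ⊖ X^ (suc n)))) N≡ ⟨
      Π ε (N ∸ j + j) · (1-x ⊖ const ε · (X^ (suc j) ⊖ X^ (suc (N ∸ j + j))))
        ≈⟨ Π-tail-step ε j (N ∸ j) ⟩
      1-x · Π ε j ∎
      where
      open SetoidReasoning (modSetoid (j + j))
      N≡ : N ∸ j + j ≡ N
      N≡ = ℕ.m∸n+n≡m (ℕ.≤-trans (ℕ.m≤m+n j j) 2j≤N)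

    -- The base of the induction on columns: the exact formula for column 1, with its finite product
    -- traded for `Π 1ℤ N`, differs from `Y` only by a multiple of `u · u`.
    y-column₁ : ∀ {j} → j + j ≤ N → y (2 + j) 1 ≈[ j + j ] Y (X^ j) (X^ 0)
    y-column₁ {j} 2j≤N = begin
      y (2 + j) 1
        ≈⟨ ≗⇒≈ (solve 2 (λ x g → (con 1ℤ :- x) :* (con 1ℤ :* (con 1ℤ :+ con -1ℤ :* x) :* g) :=
                           (con 1ℤ :- x) :* ((con 1ℤ :- x) :* g)) (λ _ → refl) x (Γ (2 + j) 1)) ⟩
      1-x · (1-x · Γ (2 + j) 1)
        ≈⟨ ≗⇒≈ (·-congˡ 1-x (Γ-column₁ j)) ⟩
      1-x · (Π 1ℤ j · (const 1ℤ ⊖ x · (x · u)))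
        ≈⟨ ≗⇒≈ (≗-sym (·-assoc 1-x (Π 1ℤ j) (const 1ℤ ⊖ x · (x · u)))) ⟩
      1-x · Π 1ℤ j · (const 1ℤ ⊖ x · (x · u))
        ≈⟨ ≈-·ʳ (const 1ℤ ⊖ x · (x · u)) (Π-tail 1ℤ 2j≤N) ⟨
      Π 1ℤ N · (1-x ⊖ const 1ℤ · X^ (suc j)) · (const 1ℤ ⊖ x · (x · u))
        ≈⟨ ≈-absorb (Π 1ℤ N · x · x · x) ℕ.≤-refl identity ⟩
      Y (X^ j) (X^ 0) ∎
      where
      open SetoidReasoning (modSetoid (j + j))
      u = X^ j
      identity : Π 1ℤ N · (1-x ⊖ const 1ℤ · X^ (suc j)) · (const 1ℤ ⊖ x · (x · u)) ≗
                 Y u (X^ 0) ⊕ X^ (j + j) · (Π 1ℤ N · x · x · x)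
      identity = ≗-trans (·-congʳ (const 1ℤ ⊖ x · (x · u)) (·-congˡ (Π 1ℤ N) (⊖-congˡ 1-x (·-congˡ (const 1ℤ) (X^-suc j)))))
        (≗-trans
          (solve 3 (λ x u P → P :* (con 1ℤ :- x :- con 1ℤ :* (x :* u)) :* (con 1ℤ :- x :* (x :* u)) :=
              P :* (con 1ℤ :- x :- x :* (x :* u) :- (x :* (x :* u) :+ x :* u) :* (con 1ℤ :- x :* con 1ℤ))
              :+ u :* u :* (P :* x :* x :* x))
            (λ _ → refl) x u (Π 1ℤ N))
          (⊕-cong (Y-cong {u} ≗-refl (≗-sym X^0)) (·-congʳ (Π 1ℤ N · x · x · x) (≗-sym (X^-+ j j)))))

    -- `Π -1ℤ` has one factor more in this column than in the column to the left, so the latter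
    -- picks up `1 - xᵇ` with `b = 2 + c`. The first two terms are then an average with weights
    -- `1 - xᵇ` and `xᵇ`, which preserves a limit common to all columns.
    y-step : ∀ {j c} → c < j →
      y (3 + j) (2 + c) ≗ (const 1ℤ ⊖ X^ (2 + c)) · y (3 + j) (1 + c) ⊕ X^ (2 + c) · y (2 + j) (2 + c)
                          ⊕ X^ (2 + j) · (y (2 + j) (2 + c) ⊖ (const 1ℤ ⊖ X^ (2 + c)) · y (2 + j) (1 + c))
    y-step {j} {c} c<j = ≗-trans
      (·-congˡ 1-x (·-congˡ (Π -1ℤ (2 + c)) (Γ-step (s≤s (s≤s c<j)))))
      (solve 7 (λ x D v g h k w →
          (con 1ℤ :- x) :* (D :* (con 1ℤ :+ con -1ℤ :* v) :* (g :+ v :* h :+ w :* (h :- k))) :=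
          (con 1ℤ :- v) :* ((con 1ℤ :- x) :* (D :* g))
          :+ v :* ((con 1ℤ :- x) :* (D :* (con 1ℤ :+ con -1ℤ :* v) :* h))
          :+ w :* ((con 1ℤ :- x) :* (D :* (con 1ℤ :+ con -1ℤ :* v) :* h)
                   :- (con 1ℤ :- v) :* ((con 1ℤ :- x) :* (D :* k))))
        (λ _ → refl) x (Π -1ℤ (1 + c)) (X^ (2 + c))
        (Γ (3 + j) (1 + c)) (Γ (2 + j) (2 + c)) (Γ (2 + j) (1 + c)) (X^ (2 + j)))

    -- `Y` solves the recurrence to first order in `u`. For `u = xʲ` the leftover factor
    -- `x · (x · (u · u))` is `x^(2j+2)`, exactly the modulus required in size `3 + j`.
    Y-step : ∀ x u s P →
      let Y = λ u s → P · (const 1ℤ ⊖ x ⊖ x · (x · u) ⊖ (x · (x · u) ⊕ x · u) · (const 1ℤ ⊖ x · s))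
          v = x · (x · s)
      in (const 1ℤ ⊖ v) · Y (x · u) s ⊕ v · Y u (x · s) ⊕ x · (x · u) · (Y u (x · s) ⊖ (const 1ℤ ⊖ v) · Y u s)
         ≗ Y (x · u) (x · s) ⊕ x · (x · (u · u)) ·
             (P · ((const 1ℤ ⊖ v) · (x · x ⊕ (x · x ⊕ x) · (const 1ℤ ⊖ x · s)) ⊖ x · x ⊖ (x · x ⊕ x) · (const 1ℤ ⊖ v)))
    Y-step = solve 4 (λ x u s P →
      let Y = λ u s → P :* (con 1ℤ :- x :- x :* (x :* u) :- (x :* (x :* u) :+ x :* u) :* (con 1ℤ :- x :* s))
          v = x :* (x :* s)
      in (con 1ℤ :- v) :* Y (x :* u) s :+ v :* Y u (x :* s) :+ x :* (x :* u) :* (Y u (x :* s) :- (con 1ℤ :- v) :* Y u s)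
         := Y (x :* u) (x :* s) :+ x :* (x :* (u :* u)) :*
             (P :* ((con 1ℤ :- v) :* (x :* x :+ (x :* x :+ x) :* (con 1ℤ :- x :* s)) :- x :* x :- (x :* x :+ x) :* (con 1ℤ :- v))))
      (λ _ → refl)

    -- Induction on the size and, within a size, on the column: `y-step` refers to the column to the
    -- left and to two columns one size lower.
    y≈Y : ∀ j c → c < j → j + j ≤ N → y (2 + j) (1 + c) ≈[ j + j ] Y (X^ j) (X^ c)

    -- At b = m - 1 only a weaker congruence is available.
    y≈Y-boundary : ∀ j c M → c < j → j + j ≤ N → M + c ≤ j + j →
                   y (2 + j) (2 + c) ≈[ M ] Y (X^ j) (X^ (suc c))

    y≈Y j       zero    _           2j≤N = y-column₁ 2j≤N
    y≈Y (suc j) (suc c) (s≤s c<j) 2j+2≤N = begin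
      y (3 + j) (2 + c)
        ≈⟨ ≗⇒≈ (y-step c<j) ⟩
      (const 1ℤ ⊖ X^ (2 + c)) · y (3 + j) (1 + c) ⊕ X^ (2 + c) · y (2 + j) (2 + c)
      ⊕ X^ (2 + j) · (y (2 + j) (2 + c) ⊖ (const 1ℤ ⊖ X^ (2 + c)) · y (2 + j) (1 + c))
        ≈⟨ ≈-⊕ (≈-⊕ (≈-·ˡ (const 1ℤ ⊖ X^ (2 + c)) (y≈Y (suc j) c (ℕ.m<n⇒m<1+n c<j) 2j+2≤N))
                    -- The factor `x^(2+c)` supplies `2 + c` of the `2j + 2` orders, so precision
                    -- `2j - c` is enough here, even at the boundary.
                    (≈-weaken (ℕ.≤-reflexive middle) (≈-X^ (2 + c) (y≈Y-boundary j c (j + j ∸ c) c<j 2j≤N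
                       (ℕ.≤-reflexive (ℕ.m∸n+n≡m c≤2j))))))
               -- The factor `x^(2+j)` leaves only `j` orders to be known.
               (≈-weaken (ℕ.≤-reflexive (cong suc (ℕ.+-suc j j))) (≈-X^ (2 + j)
                 (≈-⊖ (y≈Y-boundary j c j c<j 2j≤N (ℕ.+-monoʳ-≤ j (ℕ.<⇒≤ c<j)))
                      (≈-·ˡ (const 1ℤ ⊖ X^ (2 + c)) (≈-weaken (ℕ.m≤m+n j j) (y≈Y j c c<j 2j≤N)))))) ⟩
      (const 1ℤ ⊖ X^ (2 + c)) · Y (X^ (suc j)) s ⊕ X^ (2 + c) · Y u (X^ (suc c))
      ⊕ X^ (2 + j) · (Y u (X^ (suc c)) ⊖ (const 1ℤ ⊖ X^ (2 + c)) · Y u s)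
        ≈⟨ ≗⇒≈ (⊕-cong (⊕-cong (·-cong (⊖-congˡ (const 1ℤ) v≗) (Y-cong {s = s} (X^-suc j) ≗-refl))
                               (·-cong v≗ (Y-cong {u} ≗-refl (X^-suc c))))
                       (·-cong (X^-2+ j) (⊖-cong (Y-cong {u} ≗-refl (X^-suc c)) (·-congʳ (Y u s) (⊖-congˡ (const 1ℤ) v≗))))) ⟩
      (const 1ℤ ⊖ x · (x · s)) · Y (x · u) s ⊕ x · (x · s) · Y u (x · s)
      ⊕ x · (x · u) · (Y u (x · s) ⊖ (const 1ℤ ⊖ x · (x · s)) · Y u s)
        ≈⟨ ≈-absorb remainder ℕ.≤-refl (≗-trans (Y-step x u s (Π 1ℤ N)) (⊕-congˡ (Y (x · u) (x · s)) (·-congʳ remainder (≗-sym X^2j+2)))) ⟩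
      Y (x · u) (x · s)
        ≈⟨ ≗⇒≈ (Y-cong (X^-suc j) (X^-suc c)) ⟨
      Y (X^ (suc j)) (X^ (suc c)) ∎
      where
      open SetoidReasoning (modSetoid (suc j + suc j))
      u = X^ j
      s = X^ c
      remainder = Π 1ℤ N · ((const 1ℤ ⊖ x · (x · s)) · (x · x ⊕ (x · x ⊕ x) · (const 1ℤ ⊖ x · s))
                            ⊖ x · x ⊖ (x · x ⊕ x) · (const 1ℤ ⊖ x · (x · s)))
      2j≤N : j + j ≤ N
      2j≤N = ℕ.≤-trans (ℕ.+-mono-≤ (ℕ.n≤1+n j) (ℕ.n≤1+n j)) 2j+2≤N
      c≤2j : c ≤ j + j
      c≤2j = ℕ.≤-trans (ℕ.<⇒≤ c<j) (ℕ.m≤m+n j j)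
      middle : suc j + suc j ≡ 2 + c + (j + j ∸ c)
      middle = trans (cong suc (ℕ.+-suc j j)) (cong (λ n → 2 + n) (sym (ℕ.m+[n∸m]≡n c≤2j)))
      X^-2+ : ∀ n → X^ (2 + n) ≗ x · (x · X^ n)
      X^-2+ n = ≗-trans (X^-suc (suc n)) (·-congˡ x (X^-suc n))
      v≗ = X^-2+ c
      X^2j+2 : X^ (suc j + suc j) ≗ x · (x · (u · u))
      X^2j+2 = ≗-trans (X^-suc (j + suc j)) (·-congˡ x
        (≗-trans (λ k → cong (λ n → (X^ n) k) (ℕ.+-suc j j)) (≗-trans (X^-suc (j + j)) (·-congˡ x (X^-+ j j)))))

    y≈Y-boundary j c M c<j 2j≤N M+c≤2j with ℕ.m≤n⇒m<n∨m≡n c<j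
    ... | inj₁ 1+c<j = ≈-weaken (ℕ.≤-trans (ℕ.m≤m+n M c) M+c≤2j) (y≈Y j (suc c) 1+c<j 2j≤N)
    ... | inj₂ refl  = begin
      y (3 + c) (2 + c)
        ≈⟨ ≗⇒≈ (·-congˡ 1-x (·-congˡ (Π -1ℤ (2 + c)) (Γ-subdiagonal (suc c)))) ⟩
      1-x · (Π -1ℤ (1 + c) · (const 1ℤ ⊕ const -1ℤ · X^ (2 + c)) · Γ (3 + c) (1 + c))
        ≈⟨ ≗⇒≈ (solve 4 (λ x D v g → (con 1ℤ :- x) :* (D :* (con 1ℤ :+ con -1ℤ :* v) :* g) :=
                           (con 1ℤ :- v) :* ((con 1ℤ :- x) :* (D :* g)))
                  (λ _ → refl) x (Π -1ℤ (1 + c)) (X^ (2 + c)) (Γ (3 + c) (1 + c))) ⟩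
      (const 1ℤ ⊖ X^ (2 + c)) · y (3 + c) (1 + c)
        ≈⟨ ≈-·ˡ (const 1ℤ ⊖ X^ (2 + c)) (≈-weaken (ℕ.≤-trans (ℕ.m≤m+n M c) M+c≤2j) (y≈Y j c c<j 2j≤N)) ⟩
      (const 1ℤ ⊖ X^ (2 + c)) · Y u s
        ≈⟨ ≗⇒≈ (·-congʳ (Y u s) (⊖-congˡ (const 1ℤ) (X^-suc j))) ⟩
      (const 1ℤ ⊖ x · u) · Y u s
        -- Modulo `x · u` both `Y u s` and `Y u (x · s)` reduce to `Π 1ℤ N · 1-x`. Since
        -- `j = 1 + c`, the exponent of `x · u` is `2 + c`, which bounds `M`.
        ≈⟨ ≈-absorb remainder M≤2+c (≗-trans identity (⊕-congˡ (Y u (x · s)) (·-congʳ remainder (≗-sym (X^-suc j))))) ⟩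
      Y u (x · s)
        ≈⟨ ≗⇒≈ (Y-cong {u} ≗-refl (X^-suc c)) ⟨
      Y u (X^ (suc c)) ∎
      where
      open SetoidReasoning (modSetoid M)
      u = X^ j
      s = X^ c
      M≤2+c : M ≤ 2 + c
      M≤2+c = ℕ.+-cancelʳ-≤ c M (2 + c) (ℕ.≤-trans M+c≤2j (ℕ.≤-reflexive (cong suc (ℕ.+-suc c c))))
      remainder : PowerSeries
      remainder = Π 1ℤ N · (x ⊕ (x ⊕ const 1ℤ) · (const 1ℤ ⊖ x · (x · s))
                            ⊖ x ⊖ (x ⊕ const 1ℤ) · (const 1ℤ ⊖ x · s)) ⊖ Y u s
      identity : (const 1ℤ ⊖ x · u) · Y u s ≗ Y u (x · s) ⊕ x · u · remainder
      identity = solve 4 (λ x u s P →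
        let Y = λ u s → P :* (con 1ℤ :- x :- x :* (x :* u) :- (x :* (x :* u) :+ x :* u) :* (con 1ℤ :- x :* s)) in
        (con 1ℤ :- x :* u) :* Y u s := Y u (x :* s) :+ x :* u :* (P :* (x :+ (x :+ con 1ℤ) :* (con 1ℤ :- x :* (x :* s))
                            :- x :- (x :+ con 1ℤ) :* (con 1ℤ :- x :* s)) :- Y u s))
        (λ _ → refl) x u s (Π 1ℤ N)

    -- The factor 1 - x - xʲ⁺¹ turns the tail identity for Π -1ℤ into a
    -- congruence between Π -1ℤ N and Π -1ℤ j.
    Γ-diagonal≈ : ∀ {j} → 0 < j → j + j ≤ N →
      1-x · (1-x · (Π -1ℤ N · Γ (2 + j) (2 + j))) ≈[ j + j ]
      1-x · (Π 1ℤ N · (1-x ⊖ X^ (suc j) · (const (+ 2) ⊕ const (+ 2) · x)))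
    Γ-diagonal≈ {j@(suc c)} _ 2j≤N = begin
      1-x · (1-x · (Π -1ℤ N · A))
        ≈⟨ ≈-absorb (x · x · Π -1ℤ N · A) ℕ.≤-refl
             (≗-trans
               (solve 4 (λ x u D A → (con 1ℤ :- x) :* ((con 1ℤ :- x) :* (D :* A)) :=
                   (con 1ℤ :- x :- x :* u) :* (D :* (con 1ℤ :- x :- con -1ℤ :* (x :* u)) :* A)
                   :+ u :* u :* (x :* x :* D :* A))
                 (λ _ → refl) x u (Π -1ℤ N) A)
               (⊕-congˡ (front · (Π -1ℤ N · (1-x ⊖ const -1ℤ · (x · u)) · A)) (·-congʳ (x · x · Π -1ℤ N · A) (≗-sym (X^-+ j j))))) ⟩
      front · (Π -1ℤ N · (1-x ⊖ const -1ℤ · (x · u)) · A)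
        ≈⟨ ≗⇒≈ (·-congˡ front (·-congʳ A (·-congˡ (Π -1ℤ N) (⊖-congˡ 1-x (·-congˡ (const -1ℤ) (X^-suc j)))))) ⟨
      front · (Π -1ℤ N · (1-x ⊖ const -1ℤ · X^ (suc j)) · A)
        ≈⟨ ≈-·ˡ front (≈-·ʳ A (Π-tail -1ℤ 2j≤N)) ⟩
      front · (1-x · Π -1ℤ j · A)
        ≈⟨ ≗⇒≈ (·-congˡ front (≗-trans (·-assoc 1-x (Π -1ℤ j) A) (·-congˡ 1-x (·-congˡ (Π -1ℤ j)
             (≗-trans (Γ-diagonal (suc j)) (Γ-subdiagonal j)))))) ⟩
      front · y (2 + j) j
        ≈⟨ ≈-·ˡ front (y≈Y j c ℕ.≤-refl 2j≤N) ⟩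
      front · Y u (X^ c)
        ≈⟨ ≗⇒≈ (·-congˡ front (·-congˡ (Π 1ℤ N) (⊖-congˡ (1-x ⊖ x · (x · u))
             (·-congˡ (x · (x · u) ⊕ x · u) (⊖-congˡ (const 1ℤ) (≗-sym (X^-suc c))))))) ⟩
      front · (Π 1ℤ N · (1-x ⊖ x · (x · u) ⊖ (x · (x · u) ⊕ x · u) · (const 1ℤ ⊖ u)))
        -- Origin of `2 + 2x`: modulo `u · u` the bracket is `(1 - x) - (x + 2x²) u` and `front` is
        -- `(1 - x) - x u`, so the linear terms add up to `- (1 - x) (2x + 2x²) u`.
        ≈⟨ ≈-absorb remainder ℕ.≤-refl (≗-trans identity (⊕-cong
             (·-congˡ 1-x (·-congˡ (Π 1ℤ N) (⊖-congˡ 1-x (·-congʳ (const (+ 2) ⊕ const (+ 2) · x) (≗-sym (X^-suc j))))))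
             (·-congʳ remainder (≗-sym (X^-+ j j))))) ⟩
      1-x · (Π 1ℤ N · (1-x ⊖ X^ (suc j) · (const (+ 2) ⊕ const (+ 2) · x))) ∎
      where
      open SetoidReasoning (modSetoid (j + j))
      u = X^ j
      A = Γ (2 + j) (2 + j)
      front = 1-x ⊖ x · u
      remainder = Π 1ℤ N · (1-x · (x · x ⊕ x) ⊕ x · (x · x ⊕ (x · x ⊕ x) · (const 1ℤ ⊖ u)))
      identity : front · (Π 1ℤ N · (1-x ⊖ x · (x · u) ⊖ (x · (x · u) ⊕ x · u) · (const 1ℤ ⊖ u))) ≗
                 1-x · (Π 1ℤ N · (1-x ⊖ x · u · (const (+ 2) ⊕ const (+ 2) · x))) ⊕ u · u · remainder
      identity = solve 3 (λ x u P →
        (con 1ℤ :- x :- x :* u) :* (P :* (con 1ℤ :- x :- x :* (x :* u) :- (x :* (x :* u) :+ x :* u) :* (con 1ℤ :- u))) :=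
        (con 1ℤ :- x) :* (P :* (con 1ℤ :- x :- x :* u :* (con (+ 2) :+ con (+ 2) :* x)))
        :+ u :* u :* (P :* ((con 1ℤ :- x) :* (x :* x :+ x) :+ x :* (x :* x :+ (x :* x :+ x) :* (con 1ℤ :- u)))))
        (λ _ → refl) x u (Π 1ℤ N)

-- The product ∏ (1 + xⁱ) / (1 - xⁱ)

⊛≗· : ∀ f g → f ⊛ g ≗ f · g
⊛≗· f g k = cong-app (sym (·≡⊛ f g)) k

1/[1-xⁱ] : ℕ → PowerSeries
1/[1-xⁱ] zero      = const 1ℤ
1/[1-xⁱ] i@(suc _) = recip (const 1ℤ ⊖ X^ i) refl

·-1/[1-xⁱ] : ∀ i → (const 1ℤ ⊖ X^ (suc i)) · 1/[1-xⁱ] (suc i) ≗ const 1ℤ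
·-1/[1-xⁱ] i = ·-recip (const 1ℤ ⊖ X^ (suc i)) refl

factor≗ : ∀ i → factor (suc i) ≗ (const 1ℤ ⊕ X^ (suc i)) · 1/[1-xⁱ] (suc i)
factor≗ i = ⊛≗· (const 1ℤ ⊕ X^ (suc i)) (1/[1-xⁱ] (suc i))

factor≈1 : ∀ i → factor (suc i) ≈[ suc i ] const 1ℤ
factor≈1 i = ≈-absorb (r ⊕ r) ℕ.≤-refl (begin
  factor (suc i)                                  ≈⟨ factor≗ i ⟩
  (const 1ℤ ⊕ w) · r                              ≈⟨ solve 2 (λ w r → (con 1ℤ :+ w) :* r := (con 1ℤ :- w) :* r :+ w :* (r :+ r)) (λ _ → refl) w r ⟩
  (const 1ℤ ⊖ w) · r ⊕ w · (r ⊕ r)                ≈⟨ ⊕-cong (·-1/[1-xⁱ] i) ≗-refl ⟩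
  const 1ℤ ⊕ w · (r ⊕ r)                          ∎)
  where
  open SetoidReasoning seriesSetoid
  w = X^ (suc i)
  r = 1/[1-xⁱ] (suc i)

∏≤ : ℕ → PowerSeries
∏≤ = partialProduct factor

-- Each further factor is congruent to 1 modulo a power beyond `xᴺ`, so the coefficient of `xᵏ` is
-- frozen from `N = k` on.
∏∞≈∏≤ : ∀ N → ∏[1+xⁱ]/[1-xⁱ] ≈[ suc N ] ∏≤ N
∏∞≈∏≤ zero    zero    _ = refl
∏∞≈∏≤ zero    (suc k) (s≤s ())
∏∞≈∏≤ (suc N) k k<N+2 with ℕ.m≤n⇒m<n∨m≡n (ℕ.≤-pred k<N+2)
... | inj₂ refl  = refl
... | inj₁ k<N+1 = begin
  ∏[1+xⁱ]/[1-xⁱ] k             ≡⟨ ∏∞≈∏≤ N k k<N+1 ⟩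
  ∏≤ N k                        ≡⟨ ·-identityˡ (∏≤ N) k ⟨
  (const 1ℤ · ∏≤ N) k           ≡⟨ ·-comm (const 1ℤ) (∏≤ N) k ⟩
  (∏≤ N · const 1ℤ) k           ≡⟨ ≈-·ˡ (∏≤ N) (factor≈1 N) k k<N+1 ⟨
  (∏≤ N · factor (suc N)) k     ≡⟨ ⊛≗· (∏≤ N) (factor (suc N)) k ⟨
  ∏≤ (suc N) k                  ∎
  where open ≡-Reasoning

Π·∏≤ : ∀ N → Π -1ℤ N · ∏≤ N ≗ Π 1ℤ N
Π·∏≤ zero    = ·-identityˡ (const 1ℤ)
Π·∏≤ (suc N) = begin
  Π -1ℤ (suc N) · ∏≤ (suc N)
    ≈⟨ ·-congˡ (Π -1ℤ (suc N)) (≗-trans (⊛≗· (∏≤ N) (factor (suc N))) (·-congˡ (∏≤ N) (factor≗ N))) ⟩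
  Π -1ℤ N · (const 1ℤ ⊕ const -1ℤ · w) · (∏≤ N · ((const 1ℤ ⊕ w) · r))
    ≈⟨ solve 4 (λ D F w r → D :* (con 1ℤ :+ con -1ℤ :* w) :* (F :* ((con 1ℤ :+ w) :* r)) :=
                 D :* F :* (con 1ℤ :+ con 1ℤ :* w) :* ((con 1ℤ :- w) :* r)) (λ _ → refl) (Π -1ℤ N) (∏≤ N) w r ⟩
  Π -1ℤ N · ∏≤ N · (const 1ℤ ⊕ const 1ℤ · w) · ((const 1ℤ ⊖ w) · r)
    ≈⟨ ·-cong (·-congʳ (const 1ℤ ⊕ const 1ℤ · w) (Π·∏≤ N)) (·-1/[1-xⁱ] N) ⟩
  Π 1ℤ (suc N) · const 1ℤ
    ≈⟨ ≗-trans (·-comm (Π 1ℤ (suc N)) (const 1ℤ)) (·-identityˡ (Π 1ℤ (suc N))) ⟩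
  Π 1ℤ (suc N) ∎
  where
  open SetoidReasoning seriesSetoid
  w = X^ (suc N)
  r = 1/[1-xⁱ] (suc N)

Π⁻¹ : ∀ N → ∃ λ E → Π -1ℤ N · E ≗ const 1ℤ
Π⁻¹ zero    = const 1ℤ , ·-identityˡ (const 1ℤ)
Π⁻¹ (suc N) = let E , ΠE≗1 = Π⁻¹ N in E · r , (begin
  Π -1ℤ (suc N) · (E · r)
    ≈⟨ solve 4 (λ D E w r → D :* (con 1ℤ :+ con -1ℤ :* w) :* (E :* r) := D :* E :* ((con 1ℤ :- w) :* r))
         (λ _ → refl) (Π -1ℤ N) E w r ⟩
  Π -1ℤ N · E · ((const 1ℤ ⊖ w) · r)
    ≈⟨ ·-cong ΠE≗1 (·-1/[1-xⁱ] N) ⟩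
  const 1ℤ · const 1ℤ
    ≈⟨ ·-identityˡ (const 1ℤ) ⟩
  const 1ℤ ∎)
  where
  open SetoidReasoning seriesSetoid
  w = X^ (suc N)
  r = 1/[1-xⁱ] (suc N)

∏∞ : PowerSeries
∏∞ = ∏[1+xⁱ]/[1-xⁱ]

1-x·1/[1-x] : 1-x · 1/[1-x] ≗ const 1ℤ
1-x·1/[1-x] = ·-recip 1-x refl

2+2x : PowerSeries
2+2x = const (+ 2) ⊕ const (+ 2) · x

xⁿ⁻¹[2+2x]≗ : ∀ n → xⁿ⁻¹[2+2x] n ≗ X^ (n ∸ 1) · 2+2x
xⁿ⁻¹[2+2x]≗ n = ≗-trans (⊛≗· (X^ (n ∸ 1)) _)
  (·-congˡ (X^ (n ∸ 1)) (⊕-congˡ (const (+ 2)) (⊛≗· (const (+ 2)) x)))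

-- Series with nonnegative coefficients

NonNegative : PowerSeries → Set
NonNegative f = ∀ k → 0ℤ ℤ.≤ f k

·-nonNegative : ∀ {f g} → NonNegative f → NonNegative g → NonNegative (f · g)
·-nonNegative {f} {g} p q zero    = subst (0ℤ ℤ.≤_) (sym (·-zero f g))
  (ℤ.*-monoʳ-≤-nonNeg (g 0) ⦃ ℤ.nonNegative (q 0) ⦄ (p 0))
·-nonNegative {f} {g} p q (suc k) = subst (0ℤ ℤ.≤_) (sym (·-suc f g k))
  (ℤ.+-mono-≤ (ℤ.*-monoʳ-≤-nonNeg (g (suc k)) ⦃ ℤ.nonNegative (q (suc k)) ⦄ (p 0))
              (·-nonNegative {shift f} {g} (p ∘ suc) q k))

X^-nonNegative : ∀ m → NonNegative (X^ m)
X^-nonNegative m k with k ℕ.≡ᵇ m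
... | true  = ℤ.+≤+ z≤n
... | false = ℤ.+≤+ z≤n

const-nonNegative : ∀ n → NonNegative (const (+ n))
const-nonNegative n zero    = ℤ.+≤+ z≤n
const-nonNegative n (suc k) = ℤ.+≤+ z≤n

-- Removal of the first letter

filter-cong : ∀ {A : Set} {P Q : Pred A 0ℓ} (P? : Decidable P) (Q? : Decidable Q) {xs} →
              All (λ x → P x ⇔ Q x) xs → filter P? xs ≡ filter Q? xs
filter-cong P? Q? []                   = refl
filter-cong P? Q? {x ∷ xs} (eq ∷ eqs) with P? x | Q? x
... | yes _ | yes _ = cong (x ∷_) (filter-cong P? Q? eqs)
... | no  _ | no  _ = filter-cong P? Q? eqs
... | yes p | no ¬q = ⊥-elim (¬q (to eq p))
... | no ¬p | yes q = ⊥-elim (¬p (from eq q))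

filter-map : ∀ {A B : Set} {P : Pred B 0ℓ} (P? : Decidable P) (f : A → B) xs →
             filter P? (List.map f xs) ≡ List.map f (filter (P? ∘ f) xs)
filter-map P? f []       = refl
filter-map P? f (x ∷ xs) with does (P? (f x))
... | true  = cong (f x ∷_) (filter-map P? f xs)
... | false = filter-map P? f xs

filter-×-dec : ∀ {A : Set} {P Q : Pred A 0ℓ} (P? : Decidable P) (Q? : Decidable Q) xs →
               filter (λ x → P? x ×-dec Q? x) xs ≡ filter Q? (filter P? xs)
filter-×-dec P? Q? []       = refl
filter-×-dec P? Q? (x ∷ xs) with does (P? x) 
... | false = filter-×-dec P? Q? xs
... | true with does (Q? x)
...   | true  = cong (x ∷_) (filter-×-dec P? Q? xs)
...   | false = filter-×-dec P? Q? xs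

allFin-suc : ∀ n → allFin (suc n) ≡ zero ∷ List.map suc (allFin n)
allFin-suc n = cong (zero ∷_) (sym (List.map-tabulate (λ i → i) suc))

filter-≢-allFin : ∀ {n} (v : Fin (suc n)) →
                  filter (λ a → ¬? (v Fin.≟ a)) (allFin (suc n)) ≡ List.map (punchIn v) (allFin n)
filter-≢-allFin {n}     zero    = trans (cong (filter (λ a → ¬? (zero Fin.≟ a))) (allFin-suc n))
  (List.filter-all (λ a → ¬? (zero Fin.≟ a)) (All.map⁺ (All.universal (λ _ ()) (allFin n))))
filter-≢-allFin {suc n} (suc v) = begin
  filter v≢? (allFin (2 + n))
    ≡⟨ cong (filter v≢?) (allFin-suc (suc n)) ⟩
  zero ∷ filter v≢? (List.map suc (allFin (suc n)))
    ≡⟨ cong (zero ∷_) (filter-map v≢? suc (allFin (suc n))) ⟩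
  zero ∷ List.map suc (filter (v≢? ∘ suc) (allFin (suc n)))
    ≡⟨ cong (λ as → zero ∷ List.map suc as) (filter-cong (v≢? ∘ suc) (λ a → ¬? (v Fin.≟ a))
         (All.universal (λ a → mk⇔ (λ ≢ → ≢ ∘ cong suc) (λ ≢ → ≢ ∘ Fin.suc-injective)) (allFin (suc n)))) ⟩
  zero ∷ List.map suc (filter (λ a → ¬? (v Fin.≟ a)) (allFin (suc n)))
    ≡⟨ cong (λ as → zero ∷ List.map suc as) (filter-≢-allFin v) ⟩
  zero ∷ List.map suc (List.map (punchIn v) (allFin n))
    ≡⟨ cong (zero ∷_) (trans (sym (List.map-∘ (allFin n))) (List.map-∘ (allFin n))) ⟩
  List.map (punchIn (suc v)) (zero ∷ List.map suc (allFin n))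
    ≡⟨ cong (List.map (punchIn (suc v))) (allFin-suc n) ⟨
  List.map (punchIn (suc v)) (allFin (suc n)) ∎
  where
  open ≡-Reasoning
  v≢? : Decidable (λ a → ¬ (suc v ≡ a))
  v≢? a = ¬? (suc v Fin.≟ a)

relabel : ∀ {n m} → Fin (suc n) → Word n m → Word (suc n) m
relabel v = Vec.map (punchIn v)

avoidsLetter? : ∀ {n m} (v : Fin n) → Decidable {A = Word n m} (VecAll.All (v ≢_))
avoidsLetter? v = VecAll.all? (λ a → ¬? (v Fin.≟ a))

words-avoidingLetter : ∀ {n} m (v : Fin (suc n)) →
  filter (avoidsLetter? v) (words (suc n) m) ≡ List.map (relabel v) (words n m)
words-avoidingLetter     zero    v = refl
words-avoidingLetter {n} (suc m) v = begin
  filter (avoidsLetter? v) (cartesianProductWith _∷_ (allFin (suc n)) (words (suc n) m))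
    ≡⟨ split (allFin (suc n)) (words (suc n) m) ⟩
  cartesianProductWith _∷_ (filter (λ a → ¬? (v Fin.≟ a)) (allFin (suc n))) (filter (avoidsLetter? v) (words (suc n) m))
    ≡⟨ cong₂ (cartesianProductWith _∷_) (filter-≢-allFin v) (words-avoidingLetter m v) ⟩
  cartesianProductWith _∷_ (List.map (punchIn v) (allFin n)) (List.map (relabel v) (words n m))
    ≡⟨ join (allFin n) (words n m) ⟩
  List.map (relabel v) (words n (suc m)) ∎
  where
  open ≡-Reasoning
  prefix : ∀ a (ws : List (Word (suc n) m)) → v ≢ a → filter (avoidsLetter? v) (List.map (a ∷_) ws) ≡ List.map (a ∷_) (filter (avoidsLetter? v) ws)
  prefix a ws v≢a = trans (filter-map (avoidsLetter? v) (a ∷_) ws) (cong (List.map (a ∷_))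
    (filter-cong (avoidsLetter? v ∘ (a ∷_)) (avoidsLetter? v)
      (All.universal (λ w → mk⇔ (λ { (_ VecAll.∷ p) → p }) (v≢a VecAll.∷_)) ws)))
  split : ∀ as (ws : List (Word (suc n) m)) → filter (avoidsLetter? v) (cartesianProductWith _∷_ as ws) ≡
          cartesianProductWith _∷_ (filter (λ a → ¬? (v Fin.≟ a)) as) (filter (avoidsLetter? v) ws)
  split []       ws = refl
  split (a ∷ as) ws with v Fin.≟ a
  ... | yes refl = trans (List.filter-++ (avoidsLetter? v) (List.map (v ∷_) ws) _)
    (cong₂ _++_ (List.filter-none (avoidsLetter? v) (All.map⁺ (All.universal (λ { _ (v≢v VecAll.∷ _) → v≢v refl }) ws))) (split as ws))
  ... | no v≢a   = trans (List.filter-++ (avoidsLetter? v) (List.map (a ∷_) ws) _)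
    (cong₂ _++_ (prefix a ws v≢a) (split as ws))
  join : ∀ as (ws : List (Word n m)) → cartesianProductWith _∷_ (List.map (punchIn v) as) (List.map (relabel v) ws) ≡
         List.map (relabel v) (cartesianProductWith _∷_ as ws)
  join []       ws = refl
  join (a ∷ as) ws = sym (trans (List.map-++ (relabel v) (List.map (a ∷_) ws) _)
    (cong₂ _++_ (trans (sym (List.map-∘ ws)) (List.map-∘ ws)) (sym (join as ws))))

insert : ∀ {n} → Fin (suc n) → Word n n → Word (suc n) (suc n)
insert v σ = v ∷ relabel v σ

unique-relabel : ∀ {n m} v {w : Word n m} → Unique w ⇔ Unique (relabel v w)
unique-relabel v = mk⇔
  (λ p → AllPairs.map⁺ (AllPairs.map (λ {a} {b} a≢b → a≢b ∘ Fin.punchIn-injective v a b) p))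
  (λ p → cancel p)
  where
  cancel : ∀ {m} {w : Word _ m} → Unique (relabel v w) → Unique w
  cancel {w = []}    []       = []
  cancel {w = _ ∷ _} (p ∷ ps) = map≢ p ∷ cancel ps
    where
    map≢ : ∀ {a m} {w : Word _ m} → VecAll.All (punchIn v a ≢_) (relabel v w) → VecAll.All (a ≢_) w
    map≢ {w = []}    VecAll.[]       = VecAll.[]
    map≢ {w = _ ∷ _} (p VecAll.∷ ps) = (p ∘ cong (punchIn v)) VecAll.∷ map≢ ps

-- An equality of lists, order included: words are listed lexicographically and `punchIn v` is
-- increasing. Hence no argument up to rearrangement is needed when counting.
S-suc : ∀ n → S (suc n) ≡ cartesianProductWith insert (allFin (suc n)) (S n)
S-suc n = split (allFin (suc n))
  where
  open ≡-Reasoning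
  block : ∀ v → filter unique? (List.map (v ∷_) (words (suc n) n)) ≡ List.map (insert v) (S n)
  block v = begin
    filter unique? (List.map (v ∷_) (words (suc n) n))
      ≡⟨ filter-map unique? (v ∷_) (words (suc n) n) ⟩
    List.map (v ∷_) (filter (unique? ∘ (v ∷_)) (words (suc n) n))
      ≡⟨ cong (List.map (v ∷_)) (filter-cong (unique? ∘ (v ∷_)) (λ w → avoidsLetter? v w ×-dec unique? w)
           (All.universal (λ w → mk⇔ (λ { (p ∷ q) → p , q }) (λ (p , q) → p ∷ q)) (words (suc n) n))) ⟩
    List.map (v ∷_) (filter (λ w → avoidsLetter? v w ×-dec unique? w) (words (suc n) n))
      ≡⟨ cong (List.map (v ∷_)) (filter-×-dec (avoidsLetter? v) unique? (words (suc n) n)) ⟩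
    List.map (v ∷_) (filter unique? (filter (avoidsLetter? v) (words (suc n) n)))
      ≡⟨ cong (List.map (v ∷_) ∘ filter unique?) (words-avoidingLetter n v) ⟩
    List.map (v ∷_) (filter unique? (List.map (relabel v) (words n n)))
      ≡⟨ cong (List.map (v ∷_)) (filter-map unique? (relabel v) (words n n)) ⟩
    List.map (v ∷_) (List.map (relabel v) (filter (unique? ∘ relabel v) (words n n)))
      ≡⟨ cong (List.map (v ∷_) ∘ List.map (relabel v)) (filter-cong (unique? ∘ relabel v) unique?
           (All.universal (λ w → mk⇔ (from (unique-relabel v)) (to (unique-relabel v))) (words n n))) ⟩
    List.map (v ∷_) (List.map (relabel v) (S n))
      ≡⟨ List.map-∘ (S n) ⟨
    List.map (insert v) (S n) ∎
  split : ∀ as → filter unique? (cartesianProductWith _∷_ as (words (suc n) n)) ≡ cartesianProductWith insert as (S n)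
  split []       = refl
  split (a ∷ as) = trans (List.filter-++ unique? (List.map (a ∷_) (words (suc n) n)) _) (cong₂ _++_ (block a) (split as))

-- Replaces `Unique` as the induction principle: a permutation is built by repeatedly prepending a
-- letter.
data Perm : ∀ {n} → Word n n → Set where
  []  : Perm []
  ins : ∀ {n} (v : Fin (suc n)) {σ : Word n n} → Perm σ → Perm (insert v σ)

S-perm : ∀ n → All Perm (S n)
S-perm zero    = [] ∷ []
S-perm (suc n) = subst (All Perm) (sym (S-suc n)) (All.cartesianProductWith⁺ (setoid _) (setoid _) insert (allFin (suc n)) (S n)
  (λ _ σ∈S → ins _ (All.lookup (S-perm n) σ∈S)))

perm-surjective : ∀ {n} {σ : Word n n} → Perm σ → ∀ a → ∃ λ p → lookup σ p ≡ a
perm-surjective (ins v {σ} perm) a with v Fin.≟ a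
... | yes v≡a = zero , v≡a
... | no  v≢a = let p , σp≡ = perm-surjective perm (punchOut v≢a) in
  suc p , trans (Vec.lookup-map p (punchIn v) σ) (trans (cong (punchIn v) σp≡) (Fin.punchIn-punchOut v≢a))

-- Counting in lists

count : ∀ {A : Set} {P : Pred A 0ℓ} → Decidable P → List A → ℕ
count P? xs = length (filter P? xs)

count-cong : ∀ {A : Set} {P Q : Pred A 0ℓ} (P? : Decidable P) (Q? : Decidable Q) {xs} →
             All (λ x → P x ⇔ Q x) xs → count P? xs ≡ count Q? xs
count-cong P? Q? eqs = cong length (filter-cong P? Q? eqs)

count-map : ∀ {A B : Set} {P : Pred B 0ℓ} (P? : Decidable P) (f : A → B) xs →
            count P? (List.map f xs) ≡ count (P? ∘ f) xs
count-map P? f xs = trans (cong length (filter-map P? f xs)) (List.length-map f (filter (P? ∘ f) xs))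

count-++ : ∀ {A : Set} {P : Pred A 0ℓ} (P? : Decidable P) xs ys →
           count P? (xs ++ ys) ≡ count P? xs + count P? ys
count-++ P? xs ys = trans (cong length (List.filter-++ P? xs ys)) (List.length-++ (filter P? xs))

count-none : ∀ {A : Set} {P : Pred A 0ℓ} (P? : Decidable P) {xs} → All (¬_ ∘ P) xs → count P? xs ≡ 0
count-none P? none = cong length (List.filter-none P? none)

count-allFin-accept : ∀ {n} {P : Pred (Fin (suc n)) 0ℓ} (P? : Decidable P) → P zero →
                      count P? (allFin (suc n)) ≡ suc (count (P? ∘ suc) (allFin n))
count-allFin-accept {n} P? p = trans (cong (count P?) (allFin-suc n))
  (trans (cong length (List.filter-accept P? p)) (cong suc (count-map P? suc (allFin n))))

count-allFin-reject : ∀ {n} {P : Pred (Fin (suc n)) 0ℓ} (P? : Decidable P) → ¬ P zero →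
                      count P? (allFin (suc n)) ≡ count (P? ∘ suc) (allFin n)
count-allFin-reject {n} P? ¬p = trans (cong (count P?) (allFin-suc n))
  (trans (cong length (List.filter-reject P? ¬p)) (count-map P? suc (allFin n)))

-- Letters under relabelling, and inversions

at : ∀ {n m} → Word n m → Fin m → ℕ
at w i = toℕ (lookup w i)

punchIn-cases : ∀ {n} (v : Fin (suc n)) (s : Fin n) →
                (toℕ s < toℕ v × toℕ (punchIn v s) ≡ toℕ s) ⊎ (toℕ v ≤ toℕ s × toℕ (punchIn v s) ≡ suc (toℕ s))
punchIn-cases zero    s       = inj₂ (z≤n , refl)
punchIn-cases (suc v) zero    = inj₁ (s≤s z≤n , refl)
punchIn-cases (suc v) (suc s) = Sum.map (Product.map s≤s (cong suc)) (Product.map s≤s (cong suc)) (punchIn-cases v s)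

module Relabelled {n m} (v : Fin (suc n)) (σ : Word n m) where

  relabel-cases : ∀ i → (at σ i < toℕ v × at (relabel v σ) i ≡ at σ i) ⊎ (toℕ v ≤ at σ i × at (relabel v σ) i ≡ suc (at σ i))
  relabel-cases i rewrite Vec.lookup-map i (punchIn v) σ = punchIn-cases v (lookup σ i)

  relabel-< : ∀ i j → at (relabel v σ) i < at (relabel v σ) j ⇔ at σ i < at σ j
  relabel-< i j rewrite Vec.lookup-map i (punchIn v) σ | Vec.lookup-map j (punchIn v) σ = mk⇔
    (λ lt → ℕ.≰⇒> λ le → ℕ.<⇒≱ lt (Fin.punchIn-mono-≤ v (lookup σ j) (lookup σ i) le))
    (λ lt → ℕ.≰⇒> λ le → ℕ.<⇒≱ lt (Fin.punchIn-cancel-≤ v (lookup σ j) (lookup σ i) le))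

  <-relabel : ∀ i → toℕ v < at (relabel v σ) i ⇔ toℕ v ≤ at σ i
  <-relabel i with relabel-cases i
  ... | inj₁ (s<v , eq) rewrite eq = mk⇔ ℕ.<⇒≤ (λ v≤s → ⊥-elim (ℕ.<⇒≱ s<v v≤s))
  ... | inj₂ (v≤s , eq) rewrite eq = mk⇔ (λ _ → v≤s) (λ _ → s≤s v≤s)

  relabel-<-below : ∀ i {t} → toℕ v ≤ t → at (relabel v σ) i < suc t ⇔ at σ i < t
  relabel-<-below i v≤t with relabel-cases i
  ... | inj₁ (s<v , eq) rewrite eq = mk⇔ (λ _ → ℕ.<-≤-trans s<v v≤t) ℕ.m<n⇒m<1+n
  ... | inj₂ (v≤s , eq) rewrite eq = mk⇔ ℕ.≤-pred s≤s

  relabel-<-above : ∀ i {t} → t ≤ toℕ v → at (relabel v σ) i < t ⇔ at σ i < t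
  relabel-<-above i t≤v with relabel-cases i
  ... | inj₁ (s<v , eq) rewrite eq = mk⇔ (λ p → p) (λ p → p)
  ... | inj₂ (v≤s , eq) rewrite eq = mk⇔ (ℕ.<-trans ℕ.≤-refl) (λ s<t → ⊥-elim (ℕ.<⇒≱ (ℕ.<-≤-trans s<t t≤v) v≤s))

  ≤-relabel : ∀ i → at σ i ≤ at (relabel v σ) i
  ≤-relabel i with relabel-cases i
  ... | inj₁ (_ , eq) = ℕ.≤-reflexive (sym eq)
  ... | inj₂ (_ , eq) = ℕ.≤-trans (ℕ.n≤1+n _) (ℕ.≤-reflexive (sym eq))

  -- Relabelling raises only letters that are at least `v`. A letter that has dropped below `t` on
  -- removing `v` is therefore still at least `v`, which is where the minimum in the recurrence
  -- comes from.
  ⊓-≤ : ∀ i {t} → t ≤ at (relabel v σ) i → toℕ v ⊓ t ≤ at σ i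
  ⊓-≤ i {t} t≤ with relabel-cases i
  ... | inj₁ (_ , eq)   = ℕ.≤-trans (ℕ.m⊓n≤n (toℕ v) t) (ℕ.≤-trans t≤ (ℕ.≤-reflexive eq))
  ... | inj₂ (v≤s , eq) = ℕ.≤-trans (ℕ.m⊓n≤m (toℕ v) t) v≤s

open Relabelled

-- Needed at `t = v`, to count the inversions of a first letter `v`. Removing a first letter below
-- `t` lowers both the count and the threshold by one; any other first letter changes neither.
count-below : ∀ {n} {σ : Word n n} → Perm σ → ∀ {t} → t ≤ n → count (λ j → at σ j ℕ.<? t) (allFin n) ≡ t
count-below []                       z≤n = refl
count-below {suc n} (ins v {σ} perm) {t} t≤ with toℕ v ℕ.<? t
count-below {suc n} (ins v {σ} perm) {suc t} (s≤s t≤n) | yes (s≤s v≤t) = begin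
  count (λ j → at (insert v σ) j ℕ.<? suc t) (allFin (suc n))
    ≡⟨ count-allFin-accept (λ j → at (insert v σ) j ℕ.<? suc t) (s≤s v≤t) ⟩
  suc (count (λ j → at (relabel v σ) j ℕ.<? suc t) (allFin n))
    ≡⟨ cong suc (count-cong (λ j → at (relabel v σ) j ℕ.<? suc t) (λ j → at σ j ℕ.<? t)
         (All.universal (λ j → relabel-<-below v σ j v≤t) (allFin n))) ⟩
  suc (count (λ j → at σ j ℕ.<? t) (allFin n))
    ≡⟨ cong suc (count-below perm t≤n) ⟩
  suc t ∎
  where open ≡-Reasoning
count-below {suc n} (ins v {σ} perm) {t} _ | no v≮t = begin
  count (λ j → at (insert v σ) j ℕ.<? t) (allFin (suc n))
    ≡⟨ count-allFin-reject (λ j → at (insert v σ) j ℕ.<? t) v≮t ⟩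
  count (λ j → at (relabel v σ) j ℕ.<? t) (allFin n)
    ≡⟨ count-cong (λ j → at (relabel v σ) j ℕ.<? t) (λ j → at σ j ℕ.<? t)
         (All.universal (λ j → relabel-<-above v σ j (ℕ.≮⇒≥ v≮t)) (allFin n)) ⟩
  count (λ j → at σ j ℕ.<? t) (allFin n)
    ≡⟨ count-below perm (ℕ.≤-trans (ℕ.≮⇒≥ v≮t) (ℕ.≤-pred (Fin.toℕ<n v))) ⟩
  t ∎
  where open ≡-Reasoning

inversion? : ∀ {n} (π : Word n n) → Decidable (λ ((i , j) : Fin n × Fin n) → i Fin.< j × lookup π j Fin.< lookup π i)
inversion? π (i , j) = (i Fin.<? j) ×-dec (lookup π j Fin.<? lookup π i)

-- Pairs of positions are split by their left member: position 0 forms an inversion with each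
-- smaller letter, and the other rows are those of `σ`, as relabelling preserves order.
inversions-insert : ∀ {n} (v : Fin (suc n)) {σ : Word n n} → Perm σ →
                    inversions (insert v σ) ≡ toℕ v + inversions σ
inversions-insert {n} v {σ} perm = begin
  count inv? (cartesianProduct (allFin (suc n)) (allFin (suc n)))
    ≡⟨ cong (λ as → count inv? (cartesianProduct as (allFin (suc n)))) (allFin-suc n) ⟩
  count inv? (List.map (zero ,_) (allFin (suc n)) ++ cartesianProduct (List.map suc (allFin n)) (allFin (suc n)))
    ≡⟨ count-++ inv? (List.map (zero ,_) (allFin (suc n))) _ ⟩
  count inv? (List.map (zero ,_) (allFin (suc n))) + count inv? (cartesianProduct (List.map suc (allFin n)) (allFin (suc n)))
    ≡⟨ cong₂ _+_ first-row (other-rows (allFin n)) ⟩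
  toℕ v + inversions σ ∎
  where
  open ≡-Reasoning
  inv? = inversion? (insert v σ)
  first-row : count inv? (List.map (zero ,_) (allFin (suc n))) ≡ toℕ v
  first-row = begin
    count inv? (List.map (zero ,_) (allFin (suc n)))
      ≡⟨ count-map inv? (zero ,_) (allFin (suc n)) ⟩
    count (λ j → inv? (zero , j)) (allFin (suc n))
      ≡⟨ count-allFin-reject (λ j → inv? (zero , j)) (λ ()) ⟩
    count (λ j → inv? (zero , suc j)) (allFin n)
      ≡⟨ count-cong (λ j → inv? (zero , suc j)) (λ j → at σ j ℕ.<? toℕ v)
           (All.universal (λ j → mk⇔ (λ (_ , lt) → to (relabel-<-above v σ j ℕ.≤-refl) lt)
                                     (λ lt → s≤s z≤n , from (relabel-<-above v σ j ℕ.≤-refl) lt)) (allFin n)) ⟩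
    count (λ j → at σ j ℕ.<? toℕ v) (allFin n)
      ≡⟨ count-below perm (ℕ.≤-pred (Fin.toℕ<n v)) ⟩
    toℕ v ∎
  row : ∀ a → count inv? (List.map (suc a ,_) (allFin (suc n))) ≡ count (inversion? σ) (List.map (a ,_) (allFin n))
  row a = begin
    count inv? (List.map (suc a ,_) (allFin (suc n)))
      ≡⟨ count-map inv? (suc a ,_) (allFin (suc n)) ⟩
    count (λ j → inv? (suc a , j)) (allFin (suc n))
      ≡⟨ count-allFin-reject (λ j → inv? (suc a , j)) (λ ()) ⟩
    count (λ j → inv? (suc a , suc j)) (allFin n)
      ≡⟨ count-cong (λ j → inv? (suc a , suc j)) (λ j → inversion? σ (a , j))
           (All.universal (λ j → mk⇔ (Product.map ℕ.≤-pred (to (relabel-< v σ j a)))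
                                     (Product.map s≤s (from (relabel-< v σ j a)))) (allFin n)) ⟩
    count (λ j → inversion? σ (a , j)) (allFin n)
      ≡⟨ count-map (inversion? σ) (a ,_) (allFin n) ⟨
    count (inversion? σ) (List.map (a ,_) (allFin n)) ∎
  other-rows : ∀ as → count inv? (cartesianProduct (List.map suc as) (allFin (suc n))) ≡
                      count (inversion? σ) (cartesianProduct as (allFin n))
  other-rows []       = refl
  other-rows (a ∷ as) = trans (count-++ inv? (List.map (suc a ,_) (allFin (suc n))) _)
    (trans (cong₂ _+_ (row a) (other-rows as)) (sym (count-++ (inversion? σ) (List.map (a ,_) (allFin n)) _)))

-- The letters ≥ t of w avoid 213 and 231: w i plays the role of 2, and p and q
-- may come in either order.
Good : ∀ {n m} → ℕ → Word n m → Set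
Good t w = ∀ i p q → i Fin.< p → i Fin.< q → t ≤ at w p → at w p < at w i → at w i < at w q → ⊥

-- Avoidance of 1324 and 1342 at once, with w h w i in the role of 13.
Avoiding : ∀ {n m} → Word n m → Set
Avoiding w = ∀ h i p q → h Fin.< i → i Fin.< p → i Fin.< q →
             at w h < at w p → at w p < at w i → at w i < at w q → ⊥

good? : ∀ {n m} t → Decidable (Good {n} {m} t)
good? t w = Fin.all? λ i → Fin.all? λ p → Fin.all? λ q →
  (i Fin.<? p) →-dec (i Fin.<? q) →-dec (t ℕ.≤? at w p) →-dec (at w p ℕ.<? at w i) →-dec (at w i ℕ.<? at w q) →-dec no λ ()

avoiding? : ∀ {n m} → Decidable (Avoiding {n} {m})
avoiding? w = Fin.all? λ h → Fin.all? λ i → Fin.all? λ p → Fin.all? λ q →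
  (h Fin.<? i) →-dec (i Fin.<? p) →-dec (i Fin.<? q) →-dec
  (at w h ℕ.<? at w p) →-dec (at w p ℕ.<? at w i) →-dec (at w i ℕ.<? at w q) →-dec no λ ()

Good-mono : ∀ {n m} {w : Word n m} {s t} → s ≤ t → Good s w → Good t w
Good-mono s≤t good i p q i<p i<q t≤p = good i p q i<p i<q (ℕ.≤-trans s≤t t≤p)

Good-size : ∀ {n m} (w : Word n m) → Good n w
Good-size w i p q _ _ n≤p _ _ = ℕ.<⇒≱ (Fin.toℕ<n (lookup w p)) n≤p

-- The first letter can take part in an occurrence only as its 1; the rest of the occurrence is then
-- a 213 or 231 in the letters above `v`.
avoiding-insert : ∀ {n} (v : Fin (suc n)) (σ : Word n n) →
                  Avoiding (insert v σ) ⇔ (Avoiding σ × Good (toℕ v) σ)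
avoiding-insert v σ = mk⇔
  (λ av → (λ h i p q h<i i<p i<q hp pi iq → av (suc h) (suc i) (suc p) (suc q) (s≤s h<i) (s≤s i<p) (s≤s i<q)
                                               (r-< h p hp) (r-< p i pi) (r-< i q iq)) ,
          (λ i p q i<p i<q v≤p pi iq → av zero (suc i) (suc p) (suc q) (s≤s z≤n) (s≤s i<p) (s≤s i<q)
                                          (from (<-relabel v σ p) v≤p) (r-< p i pi) (r-< i q iq)))
  (λ { (av , good) zero (suc i) (suc p) (suc q) _ (s≤s i<p) (s≤s i<q) hp pi iq →
         good i p q i<p i<q (to (<-relabel v σ p) hp) (u-< p i pi) (u-< i q iq)
     ; (av , good) (suc h) (suc i) (suc p) (suc q) (s≤s h<i) (s≤s i<p) (s≤s i<q) hp pi iq →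
         av h i p q h<i i<p i<q (u-< h p hp) (u-< p i pi) (u-< i q iq) })
  where
  r-< : ∀ i j → at σ i < at σ j → at (relabel v σ) i < at (relabel v σ) j
  r-< i j = from (relabel-< v σ i j)
  u-< : ∀ i j → at (relabel v σ) i < at (relabel v σ) j → at σ i < at σ j
  u-< i j = to (relabel-< v σ i j)

-- For t < v < n the word v ∷ σ has the letters t and v + 1 after v, an
-- occurrence of 213 or 231.
good-insert : ∀ {n} (v : Fin (suc n)) {σ : Word n n} t → Perm σ → Good (toℕ v) σ →
              Good t (insert v σ) ⇔ ((toℕ v ≤ t ⊎ toℕ v ≡ n) × Good (toℕ v ⊓ t) σ)
good-insert {n} v {σ} t perm good-v = mk⇔ (λ good → position good , good-⊓ good) (λ (pos , good) → backward pos good)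
  where
  position : Good t (insert v σ) → toℕ v ≤ t ⊎ toℕ v ≡ n
  position good with toℕ v ℕ.≤? t | toℕ v ℕ.≟ n
  ... | yes v≤t | _       = inj₁ v≤t
  ... | no  _   | yes v≡n = inj₂ v≡n
  ... | no  v≰t | no v≢n  = ⊥-elim (good zero (suc p) (suc q) (s≤s z≤n) (s≤s z≤n)
      (ℕ.≤-trans (ℕ.≤-reflexive (sym p-t)) (≤-relabel v σ p))
      (from (relabel-<-above v σ p ℕ.≤-refl) (subst (_< toℕ v) (sym p-t) t<v))
      (from (<-relabel v σ q) (ℕ.≤-reflexive (sym q-v))))
    where
    t<v = ℕ.≰⇒> v≰t
    v<n = ℕ.≤∧≢⇒< (ℕ.≤-pred (Fin.toℕ<n v)) v≢n
    t<n = ℕ.<-trans t<v v<n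
    p   = proj₁ (perm-surjective perm (Fin.fromℕ< t<n))
    q   = proj₁ (perm-surjective perm (Fin.fromℕ< v<n))
    p-t : at σ p ≡ t
    p-t = trans (cong toℕ (proj₂ (perm-surjective perm (Fin.fromℕ< t<n)))) (Fin.toℕ-fromℕ< t<n)
    q-v : at σ q ≡ toℕ v
    q-v = trans (cong toℕ (proj₂ (perm-surjective perm (Fin.fromℕ< v<n)))) (Fin.toℕ-fromℕ< v<n)
  good-⊓ : Good t (insert v σ) → Good (toℕ v ⊓ t) σ
  good-⊓ good with ℕ.⊓-sel (toℕ v) t
  -- If `v` is the minimum, goodness of the inserted word says too little about the letters between
  -- `v` and `t`; the avoidance hypothesis `good-v` covers them.
  ... | inj₁ eq = subst (λ s → Good s σ) (sym eq) good-v
  ... | inj₂ eq = subst (λ s → Good s σ) (sym eq)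
    λ i p q i<p i<q t≤p pi iq → good (suc i) (suc p) (suc q) (s≤s i<p) (s≤s i<q) (ℕ.≤-trans t≤p (≤-relabel v σ p))
      (from (relabel-< v σ p i) pi) (from (relabel-< v σ i q) iq)
  backward : toℕ v ≤ t ⊎ toℕ v ≡ n → Good (toℕ v ⊓ t) σ → Good t (insert v σ)
  -- The first letter as the 2 of an occurrence: for `v ≤ t` no letter fits between `t` and `v` as
  -- the 1, and for `v ≡ n` no letter exceeds `v` as the 3.
  backward (inj₁ v≤t) good zero (suc p) (suc q) _ _ t≤p p<v _ = ℕ.<⇒≱ p<v (ℕ.≤-trans v≤t t≤p)
  backward (inj₂ v≡n) good zero (suc p) (suc q) _ _ _ _ v<q =
    ℕ.<⇒≱ (Fin.toℕ<n (lookup σ q)) (ℕ.≤-trans (ℕ.≤-reflexive (sym v≡n)) (to (<-relabel v σ q) v<q))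
  backward _ good (suc i) (suc p) (suc q) (s≤s i<p) (s≤s i<q) t≤p pi iq =
    good i p q i<p i<q (⊓-≤ v σ p t≤p) (to (relabel-< v σ p i) pi) (to (relabel-< v σ i q) iq)

-- From pattern containment to `Avoiding`

AllPairs-lookup : ∀ {A : Set} {R : A → A → Set} {m} {xs : Vec A m} → AllPairs R xs →
                  ∀ {i j} → i Fin.< j → R (lookup xs i) (lookup xs j)
AllPairs-lookup (r ∷ rs) {zero}  {suc j} _         = VecAll.lookup r (∈-lookup j _)
AllPairs-lookup (r ∷ rs) {suc i} {suc j} (s≤s i<j) = AllPairs-lookup rs i<j

-- A strictly increasing map `f` from the letters of the pattern to those of `u` replaces the
-- comparison of all pairs of positions.
orderIsomorphic : ∀ {n m l} (u : Word n m) (q : Word l m) (f : Fin l → Fin n) →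
                  (∀ {a b} → a Fin.< b → f a Fin.< f b) → (∀ i → lookup u i ≡ f (lookup q i)) → OrderIsomorphic u q
orderIsomorphic u q f f-mono u≡ i j rewrite u≡ i | u≡ j = mk⇔ reflects f-mono
  where
  reflects : f (lookup q i) Fin.< f (lookup q j) → lookup q i Fin.< lookup q j
  reflects lt with Fin.<-cmp (lookup q i) (lookup q j)
  ... | tri< a _ _ = a
  ... | tri≈ _ b _ = ⊥-elim (ℕ.<-irrefl (cong (toℕ ∘ f) b) lt)
  ... | tri> _ _ c = ⊥-elim (ℕ.<-asym lt (f-mono c))

increasing : ∀ {n} {a b c d : Fin n} → a Fin.< b → b Fin.< c → c Fin.< d → AllPairs Fin._<_ (a ∷ b ∷ c ∷ d ∷ [])
increasing p q r =
  (p ∷ ℕ.<-trans p q ∷ ℕ.<-trans (ℕ.<-trans p q) r ∷ []) ∷ (q ∷ ℕ.<-trans q r ∷ []) ∷ (r ∷ []) ∷ [] ∷ []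

-- 1324 and 1342 differ only in the order of the positions `p` of the 2 and `q` of the 4. Comparing
-- `p` with `q` selects the pattern; `p ≡ q` would make one letter both smaller and larger than
-- `w i`.
avoids⇔avoiding : ∀ {n} (π : Word n n) → All (Avoids π) (p1324 ∷ p1342 ∷ []) ⇔ Avoiding π
avoids⇔avoiding {n} π = mk⇔ forward (λ av → contains-1324 av ∷ contains-1342 av ∷ [])
  where
  contains-1324 : Avoiding π → Avoids π p1324
  contains-1324 av (h ∷ i ∷ p ∷ q ∷ [] , e , iso) = av h i p q
    (AllPairs-lookup e {0F} {1F} (s≤s z≤n)) (AllPairs-lookup e {1F} {2F} (s≤s (s≤s z≤n))) (AllPairs-lookup e {1F} {3F} (s≤s (s≤s z≤n)))
    (from (iso 0F 2F) (s≤s z≤n)) (from (iso 2F 1F) (s≤s (s≤s z≤n))) (from (iso 1F 3F) (s≤s (s≤s (s≤s z≤n))))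
    where open import Data.Fin.Patterns
  contains-1342 : Avoiding π → Avoids π p1342
  contains-1342 av (h ∷ i ∷ q ∷ p ∷ [] , e , iso) = av h i p q
    (AllPairs-lookup e {0F} {1F} (s≤s z≤n)) (AllPairs-lookup e {1F} {3F} (s≤s (s≤s z≤n))) (AllPairs-lookup e {1F} {2F} (s≤s (s≤s z≤n)))
    (from (iso 0F 3F) (s≤s z≤n)) (from (iso 3F 1F) (s≤s (s≤s z≤n))) (from (iso 1F 2F) (s≤s (s≤s (s≤s z≤n))))
    where open import Data.Fin.Patterns
  forward : All (Avoids π) (p1324 ∷ p1342 ∷ []) → Avoiding π
  forward (¬1324 ∷ ¬1342 ∷ []) h i p q h<i i<p i<q hp pi iq with Fin.<-cmp p q
  ... | tri< p<q _ _  = ¬1324 (h ∷ i ∷ p ∷ q ∷ [] , increasing h<i i<p p<q ,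
    orderIsomorphic (Vec.map (lookup π) (h ∷ i ∷ p ∷ q ∷ [])) (proj₂ p1324) (lookup (lookup π h ∷ lookup π p ∷ lookup π i ∷ lookup π q ∷ [])) (AllPairs-lookup (increasing hp pi iq))
      (λ { zero → refl ; (suc zero) → refl ; (suc (suc zero)) → refl ; (suc (suc (suc zero))) → refl }))
  ... | tri≈ _ refl _ = ℕ.<-asym pi iq
  ... | tri> _ _ q<p  = ¬1342 (h ∷ i ∷ q ∷ p ∷ [] , increasing h<i i<q q<p ,
    orderIsomorphic (Vec.map (lookup π) (h ∷ i ∷ q ∷ p ∷ [])) (proj₂ p1342) (lookup (lookup π h ∷ lookup π p ∷ lookup π i ∷ lookup π q ∷ [])) (AllPairs-lookup (increasing hp pi iq))
      (λ { zero → refl ; (suc zero) → refl ; (suc (suc zero)) → refl ; (suc (suc (suc zero))) → refl }))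

-- Generating functions

sumTo-cong : ∀ {f g} n → (∀ v → v ≤ n → f v ≗ g v) → sumTo f n ≗ sumTo g n
sumTo-cong zero    p = p 0 z≤n
sumTo-cong (suc n) p = ⊕-cong (sumTo-cong n (λ v v≤n → p v (ℕ.m≤n⇒m≤1+n v≤n))) (p (suc n) ℕ.≤-refl)

sumTo-truncate : ∀ {f t n} → t ℕ.≤′ n → (∀ v → t < v → v ≤ n → f v ≗ 𝟘) → sumTo f n ≗ sumTo f t
sumTo-truncate ℕ.≤′-refl           p = ≗-refl
sumTo-truncate (ℕ.≤′-step {n} t≤n) p k =
  trans (cong₂ ℤ._+_ (sumTo-truncate t≤n (λ v t<v v≤n → p v t<v (ℕ.m≤n⇒m≤1+n v≤n)) k)
                     (p (suc n) (s≤s (ℕ.≤′⇒≤ t≤n)) ℕ.≤-refl k))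
        (ℤ.+-identityʳ _)

sumTo-head : ∀ f n k → sumTo f (suc n) k ≡ f 0 k ℤ.+ sumTo (f ∘ suc) n k
sumTo-head f zero    k = refl
sumTo-head f (suc n) k = trans (cong (λ a → a ℤ.+ f (2 + n) k) (sumTo-head f n k))
                               (ℤ.+-assoc (f 0 k) (sumTo (f ∘ suc) n k) (f (2 + n) k))

count-cartesianProductWith : ∀ {A B C : Set} {P : Pred C 0ℓ} (P? : Decidable P) (f : A → B → C) as bs →
  count P? (cartesianProductWith f as bs) ≡ sumℕ (List.map (λ a → count (P? ∘ f a) bs) as)
count-cartesianProductWith P? f []       bs = refl
count-cartesianProductWith P? f (a ∷ as) bs = trans (count-++ P? (List.map (f a) bs) _)
  (cong₂ _+_ (count-map P? (f a) bs) (count-cartesianProductWith P? f as bs))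

sum-allFin : ∀ n (c : Fin (suc n) → ℕ) (g : ℕ → PowerSeries) k → (∀ v → + c v ≡ g (toℕ v) k) →
             + sumℕ (List.map c (allFin (suc n))) ≡ sumTo g n k
sum-allFin zero    c g k p = trans (cong +_ (ℕ.+-identityʳ (c zero))) (p zero)
sum-allFin (suc n) c g k p = begin
  + sumℕ (List.map c (allFin (2 + n)))
    ≡⟨ cong (+_ ∘ sumℕ ∘ List.map c) (allFin-suc (suc n)) ⟩
  + (c zero + sumℕ (List.map c (List.map suc (allFin (suc n)))))
    ≡⟨ cong (λ as → + (c zero + sumℕ as)) (List.map-∘ (allFin (suc n))) ⟨
  + (c zero + sumℕ (List.map (c ∘ suc) (allFin (suc n))))
    ≡⟨ ℤ.pos-+ (c zero) _ ⟩
  + c zero ℤ.+ + sumℕ (List.map (c ∘ suc) (allFin (suc n)))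
    ≡⟨ cong₂ ℤ._+_ (p zero) (sum-allFin n (c ∘ suc) (g ∘ suc) k (p ∘ suc)) ⟩
  g 0 k ℤ.+ sumTo (g ∘ suc) n k
    ≡⟨ sumTo-head g n k ⟨
  sumTo g (suc n) k ∎
  where open ≡-Reasoning

Counted : ∀ {n} → ℕ → ℕ → Word n n → Set
Counted t k σ = inversions σ ≡ k × Avoiding σ × Good t σ

counted? : ∀ {n} t k → Decidable (Counted {n} t k)
counted? t k σ = (inversions σ ℕ.≟ k) ×-dec (avoiding? σ ×-dec good? t σ)

-- Opaque, since comparing unfolded coefficients would enumerate permutations.
opaque
  Γ : ℕ → ℕ → PowerSeries
  Γ m t k = + count (counted? t k) (S m)

  Γ≡count : ∀ m t k → Γ m t k ≡ + count (counted? t k) (S m)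
  Γ≡count m t k = refl

  Γ-zero : Γ 0 0 ≗ const 1ℤ
  Γ-zero zero    = refl
  Γ-zero (suc k) = refl

-- The permutations counted by Γ (suc m) t whose first letter is v.
summand : ℕ → ℕ → ℕ → PowerSeries
summand m t v with (v ℕ.≤? t) ⊎-dec (v ℕ.≟ m)
... | yes _ = X^ v · Γ m (v ⊓ t)
... | no  _ = 𝟘

summand-accepted : ∀ {m t v} → v ≤ t ⊎ v ≡ m → summand m t v ≗ X^ v · Γ m (v ⊓ t)
summand-accepted {m} {t} {v} pos with (v ℕ.≤? t) ⊎-dec (v ℕ.≟ m)
... | yes _   = ≗-refl
... | no ¬pos = ⊥-elim (¬pos pos)

summand-rejected : ∀ {m t v} → ¬ (v ≤ t ⊎ v ≡ m) → summand m t v ≗ 𝟘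
summand-rejected {m} {t} {v} ¬pos with (v ℕ.≤? t) ⊎-dec (v ℕ.≟ m)
... | yes pos = ⊥-elim (¬pos pos)
... | no _    = ≗-refl

-- The condition `Good (toℕ v) σ` coming from avoidance leaves no trace on the right, because
-- `Good (toℕ v ⊓ t) σ` implies it.
counted-insert : ∀ {n} (v : Fin (suc n)) {σ : Word n n} t k → Perm σ →
  Counted t k (insert v σ) ⇔ (toℕ v + inversions σ ≡ k × (toℕ v ≤ t ⊎ toℕ v ≡ n) × Avoiding σ × Good (toℕ v ⊓ t) σ)
counted-insert v {σ} t k perm = mk⇔
  (λ (inv , av , good) → let av′ , good-v = to (avoiding-insert v σ) av
                             pos , good′  = to (good-insert v t perm good-v) good
                         in trans (sym (inversions-insert v perm)) inv , pos , av′ , good′)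
  (λ (inv , pos , av , good) → let good-v = Good-mono {w = σ} (ℕ.m⊓n≤m (toℕ v) t) good
                               in trans (inversions-insert v perm) inv , from (avoiding-insert v σ) (av , good-v) ,
                                  from (good-insert v t perm good-v) (pos , good))

Γ-suc : ∀ m t → Γ (suc m) t ≗ sumTo (summand m t) m
Γ-suc m t k = begin
  Γ (suc m) t k
    ≡⟨ Γ≡count (suc m) t k ⟩
  + count (counted? t k) (S (suc m))
    ≡⟨ cong (+_ ∘ count (counted? t k)) (S-suc m) ⟩
  + count (counted? t k) (cartesianProductWith insert (allFin (suc m)) (S m))
    ≡⟨ cong +_ (count-cartesianProductWith (counted? t k) insert (allFin (suc m)) (S m)) ⟩
  + sumℕ (List.map (λ v → count (counted? t k ∘ insert v) (S m)) (allFin (suc m)))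
    ≡⟨ sum-allFin m (λ v → count (counted? t k ∘ insert v) (S m)) (summand m t) k
         (λ v → first-letter v ((toℕ v ℕ.≤? t) ⊎-dec (toℕ v ℕ.≟ m)) (k ℕ.<? toℕ v)) ⟩
  sumTo (summand m t) m k ∎
  where
  open ≡-Reasoning
  none : ∀ v → (∀ {σ} → Perm σ → ¬ Counted t k (insert v σ)) → + count (counted? t k ∘ insert v) (S m) ≡ 0ℤ
  none v ¬counted = cong +_ (count-none (counted? t k ∘ insert v) (All.map ¬counted (S-perm m)))
  first-letter : ∀ v → Dec (toℕ v ≤ t ⊎ toℕ v ≡ m) → Dec (k < toℕ v) →
                 + count (counted? t k ∘ insert v) (S m) ≡ summand m t (toℕ v) k
  first-letter v (no ¬pos) _ = trans
    (none v (λ perm c → ¬pos (proj₁ (proj₂ (to (counted-insert v t k perm) c)))))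
    (sym (summand-rejected ¬pos k))
  -- The first letter alone accounts for `v` inversions, more than `k`.
  first-letter v (yes pos) (yes k<v) = trans
    (none v (λ perm c → ℕ.<⇒≱ k<v (ℕ.≤-trans (ℕ.m≤m+n (toℕ v) _) (ℕ.≤-reflexive (proj₁ (to (counted-insert v t k perm) c))))))
    (sym (trans (summand-accepted pos k) (X^-·-< (toℕ v) (Γ m (toℕ v ⊓ t)) k<v)))
  first-letter v (yes pos) (no k≮v) = begin
    + count (counted? t k ∘ insert v) (S m)
      ≡⟨ cong +_ (count-cong (counted? t k ∘ insert v) (counted? (toℕ v ⊓ t) (k ∸ toℕ v)) (All.map equiv (S-perm m))) ⟩
    + count (counted? (toℕ v ⊓ t) (k ∸ toℕ v)) (S m)
      ≡⟨ Γ≡count m (toℕ v ⊓ t) (k ∸ toℕ v) ⟨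
    Γ m (toℕ v ⊓ t) (k ∸ toℕ v)
      ≡⟨ X^-· (toℕ v) (Γ m (toℕ v ⊓ t)) (k ∸ toℕ v) ⟨
    (X^ (toℕ v) · Γ m (toℕ v ⊓ t)) (toℕ v + (k ∸ toℕ v))
      ≡⟨ cong (X^ (toℕ v) · Γ m (toℕ v ⊓ t)) v+[k∸v] ⟩
    (X^ (toℕ v) · Γ m (toℕ v ⊓ t)) k
      ≡⟨ summand-accepted pos k ⟨
    summand m t (toℕ v) k ∎
    where
    v+[k∸v] : toℕ v + (k ∸ toℕ v) ≡ k
    v+[k∸v] = ℕ.m+[n∸m]≡n (ℕ.≮⇒≥ k≮v)
    equiv : ∀ {σ} → Perm σ → Counted t k (insert v σ) ⇔ Counted (toℕ v ⊓ t) (k ∸ toℕ v) σ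
    equiv {σ} perm = mk⇔
      (λ c → let inv , _ , rest = to (counted-insert v t k perm) c in
             ℕ.+-cancelˡ-≡ (toℕ v) (inversions σ) (k ∸ toℕ v) (trans inv (sym v+[k∸v])) , rest)
      (λ (inv , rest) → from (counted-insert v t k perm) (trans (cong (λ i → toℕ v + i) inv) v+[k∸v] , pos , rest))

summand-≤ : ∀ {m t v} → v ≤ t → summand m t v ≗ X^ v · Γ m v
summand-≤ {m} {t} {v} v≤t k = trans (summand-accepted (inj₁ v≤t) k)
  (cong (λ s → (X^ v · Γ m s) k) (ℕ.m≤n⇒m⊓n≡m v≤t))

summand-max : ∀ {m t} → t < m → summand m t m ≗ X^ m · Γ m t
summand-max {m} {t} t<m k = trans (summand-accepted (inj₂ refl) k)
  (cong (λ s → (X^ m · Γ m s) k) (ℕ.m≥n⇒m⊓n≡n (ℕ.<⇒≤ t<m)))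

Γ-suc-≥ : ∀ {m t} → m ≤ t → Γ (suc m) t ≗ sumTo (λ v → X^ v · Γ m v) m
Γ-suc-≥ {m} {t} m≤t = ≗-trans (Γ-suc m t) (sumTo-cong m (λ v v≤m → summand-≤ (ℕ.≤-trans v≤m m≤t)))

Γ-suc-< : ∀ {m t} → t < m → Γ (suc m) t ≗ sumTo (λ v → X^ v · Γ m v) t ⊕ X^ m · Γ m t
Γ-suc-< {suc m} {t} t<m@(s≤s t≤m) = ≗-trans (Γ-suc (suc m) t) (⊕-cong
  (≗-trans (sumTo-truncate (ℕ.≤⇒≤′ t≤m) (λ v t<v v≤m → summand-rejected (λ
    { (inj₁ v≤t) → ℕ.<⇒≱ t<v v≤t ; (inj₂ refl) → ℕ.<⇒≱ ℕ.≤-refl v≤m })))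
           (sumTo-cong t (λ v v≤t → summand-≤ v≤t)))
  (summand-max t<m))

-- At threshold `n` no letter is large enough to be constrained, so `Counted n k` is avoidance with
-- `k` inversions.
av≡Γ : ∀ n k → + av n k (p1324 ∷ p1342 ∷ []) ≡ Γ n n k
av≡Γ n k = trans (cong +_ (count-cong (λ π → (inversions π ℕ.≟ k) ×-dec All.all? (avoids? π) (p1324 ∷ p1342 ∷ [])) (counted? n k)
  (All.universal (λ π → mk⇔ (Product.map₂ (λ a → to (avoids⇔avoiding π) a , Good-size π))
                            (Product.map₂ (λ (a , _) → from (avoids⇔avoiding π) a))) (S n))))
  (sym (Γ≡count n n k))

-- Coefficients of the diagonal and the theorem

open Recurrence Γ Γ-zero Γ-suc-< Γ-suc-≥

seriesFor : ℕ → PowerSeries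
seriesFor n = (1-x ⊖ X^ (n ∸ 1) · 2+2x) · 1/[1-x] · ∏∞

Γ-diagonal≈seriesFor : ∀ j → 0 < j → Γ (2 + j) (2 + j) ≈[ j + j ] seriesFor (2 + j)
Γ-diagonal≈seriesFor j 0<j = ≈-cancel 1/[1-x] 1-x·1/[1-x] (begin
  1-x · A
    ≈⟨ ≈-cancel (proj₁ (Π⁻¹ N)) (proj₂ (Π⁻¹ N)) cleared ⟩
  ∏≤ N · B
    ≈⟨ ≈-·ʳ B (≈-weaken (ℕ.n≤1+n N) (∏∞≈∏≤ N)) ⟨
  ∏∞ · B
    ≈⟨ ≗⇒≈ (·-congʳ B (·-identityˡ ∏∞)) ⟨
  const 1ℤ · ∏∞ · B
    ≈⟨ ≗⇒≈ (·-congʳ B (·-congʳ ∏∞ 1-x·1/[1-x])) ⟨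
  1-x · 1/[1-x] · ∏∞ · B
    ≈⟨ ≗⇒≈ (solve 4 (λ f r P B → f :* r :* P :* B := f :* (B :* r :* P)) (λ _ → refl) 1-x 1/[1-x] ∏∞ B) ⟩
  1-x · seriesFor (2 + j) ∎)
  where
  -- The least truncation that `Γ-diagonal≈` admits; modulo `xᴺ` the finite product `∏≤ N` already
  -- agrees with `∏∞`.
  N = j + j
  open SetoidReasoning (modSetoid N)
  A = Γ (2 + j) (2 + j)
  B = 1-x ⊖ X^ (suc j) · 2+2x
  cleared : Π -1ℤ N · (1-x · A) ≈[ N ] Π -1ℤ N · (∏≤ N · B)
  cleared = begin
    Π -1ℤ N · (1-x · A)
      ≈⟨ ≗⇒≈ (solve 3 (λ D f A → D :* (f :* A) := f :* (D :* A)) (λ _ → refl) (Π -1ℤ N) 1-x A) ⟩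
    1-x · (Π -1ℤ N · A)
      ≈⟨ ≈-cancel 1/[1-x] 1-x·1/[1-x] (Γ-diagonal≈ N 0<j ℕ.≤-refl) ⟩
    Π 1ℤ N · B
      ≈⟨ ≗⇒≈ (·-congʳ B (Π·∏≤ N)) ⟨
    Π -1ℤ N · ∏≤ N · B
      ≈⟨ ≗⇒≈ (·-assoc (Π -1ℤ N) (∏≤ N) B) ⟩
    Π -1ℤ N · (∏≤ N · B) ∎

Γ-diagonal-coefficient : ∀ k n → k + 7 ≤ 2 * n → Γ n n k ≡ seriesFor n k
Γ-diagonal-coefficient k n k+7≤2n with ℕ.≤-trans (ℕ.m≤n+m 7 k) k+7≤2n
Γ-diagonal-coefficient k 0 _ | ()
Γ-diagonal-coefficient k 1 _ | s≤s (s≤s ())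
Γ-diagonal-coefficient k 2 _ | s≤s (s≤s (s≤s (s≤s ())))
Γ-diagonal-coefficient k (suc (suc j@(suc _))) k+7≤2n | _ = Γ-diagonal≈seriesFor j (s≤s z≤n) k k<2j
  where
  k<2j : k < j + j
  -- With `n = 2 + j`, adding 4 turns the goal into `4 + suc k ≤ 2 * n`, while the hypothesis reads
  -- `6 + suc k ≤ 2 * n`.
  k<2j = ℕ.+-cancelˡ-≤ 4 (suc k) (j + j) (ℕ.≤-trans (ℕ.+-monoˡ-≤ (suc k) (ℕ.m≤m+n 4 2))
    (subst₂ _≤_ (solveℕ 1 (λ k → k +ℕ conℕ 7 =ℕ conℕ 7 +ℕ k) refl k)
                (solveℕ 1 (λ j → conℕ 2 *ℕ (conℕ 2 +ℕ j) =ℕ conℕ 4 +ℕ (j +ℕ j)) refl j) k+7≤2n))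

-- Consecutive numerators differ by `(1 - x) xⁿ (2 + 2x)`, whose factor `1 - x` cancels the
-- denominator.
seriesFor-step : ∀ n → seriesFor (suc (suc n)) ⊖ seriesFor (suc n) ≗ X^ n · 2+2x · ∏∞
seriesFor-step n = begin
  seriesFor (suc (suc n)) ⊖ seriesFor (suc n)
    ≈⟨ ⊖-cong (·-congʳ ∏∞ (·-congʳ 1/[1-x] (⊖-congˡ 1-x (·-congʳ 2+2x (X^-suc n))))) ≗-refl ⟩
  (1-x ⊖ x · X^ n · 2+2x) · 1/[1-x] · ∏∞ ⊖ (1-x ⊖ X^ n · 2+2x) · 1/[1-x] · ∏∞
    ≈⟨ solve 5 (λ x u p r P → (con 1ℤ :- x :- x :* u :* p) :* r :* P :- (con 1ℤ :- x :- u :* p) :* r :* P :=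
                 (con 1ℤ :- x) :* r :* (u :* p :* P)) (λ _ → refl) x (X^ n) 2+2x 1/[1-x] ∏∞ ⟩
  1-x · 1/[1-x] · (X^ n · 2+2x · ∏∞)
    ≈⟨ ·-congʳ (X^ n · 2+2x · ∏∞) 1-x·1/[1-x] ⟩
  const 1ℤ · (X^ n · 2+2x · ∏∞)
    ≈⟨ ·-identityˡ (X^ n · 2+2x · ∏∞) ⟩
  X^ n · 2+2x · ∏∞ ∎
  where open SetoidReasoning seriesSetoid

seriesFor≈∏∞ : ∀ n → seriesFor (suc n) ≈[ n ] ∏∞
seriesFor≈∏∞ n = ≈-absorb (⊝ (2+2x · 1/[1-x] · ∏∞)) ℕ.≤-refl (begin
  seriesFor (suc n)
    ≈⟨ solve 5 (λ f u p r P → (f :- u :* p) :* r :* P := f :* r :* P :+ u :* SeriesSolver.:- (p :* r :* P))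
         (λ _ → refl) 1-x (X^ n) 2+2x 1/[1-x] ∏∞ ⟩
  1-x · 1/[1-x] · ∏∞ ⊕ X^ n · (⊝ (2+2x · 1/[1-x] · ∏∞))
    ≈⟨ ⊕-cong (≗-trans (·-congʳ ∏∞ 1-x·1/[1-x]) (·-identityˡ ∏∞)) ≗-refl ⟩
  ∏∞ ⊕ X^ n · (⊝ (2+2x · 1/[1-x] · ∏∞)) ∎)
  where open SetoidReasoning seriesSetoid

-- One bound does two things: it brings `n` into the range of the coefficient formula and pushes the
-- correction, which starts at `xⁿ⁻¹`, beyond `xᵏ`.
Γ-limit : ∀ k n → k + 7 ≤ n → Γ n n k ≡ ∏∞ k
Γ-limit k (suc n) k+7≤n = trans
  (Γ-diagonal-coefficient k (suc n) (ℕ.≤-trans k+7≤n (ℕ.m≤m+n (suc n) (1 * suc n))))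
  (seriesFor≈∏∞ n k (ℕ.≤-pred (ℕ.≤-trans (ℕ.≤-trans (ℕ.≤-reflexive (ℕ.+-comm 2 k)) (ℕ.+-monoʳ-≤ k {2} {7} (s≤s (s≤s z≤n)))) k+7≤n)))
Γ-limit k zero k+7≤0 with ℕ.≤-trans (ℕ.m≤n+m 7 k) k+7≤0
... | ()

-- Read off from the limit: the coefficient of `xᵏ` counts permutations of size `k + 7`.
∏∞-nonNegative : NonNegative ∏∞
∏∞-nonNegative k = subst (0ℤ ℤ.≤_) (Γ-limit k (k + 7) ℕ.≤-refl) (subst (0ℤ ℤ.≤_) (sym (Γ≡count (k + 7) (k + 7) k)) (ℤ.+≤+ z≤n))

difference : ∀ k n → k + 7 ≤ 2 * n → Γ (suc n) (suc n) k ℤ.- Γ n n k ≡ (X^ (n ∸ 1) · 2+2x · ∏∞) k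
difference k zero    k+7≤0 with ℕ.≤-trans (ℕ.m≤n+m 7 k) k+7≤0
... | ()
difference k n@(suc n-1) k+7≤2n = trans
  (cong₂ ℤ._-_ (Γ-diagonal-coefficient k (suc n) (ℕ.≤-trans k+7≤2n (ℕ.*-monoʳ-≤ 2 (ℕ.n≤1+n n))))
               (Γ-diagonal-coefficient k n k+7≤2n))
  (seriesFor-step n-1 k)

difference-nonNegative : ∀ n → NonNegative (X^ (n ∸ 1) · 2+2x · ∏∞)
difference-nonNegative n = ·-nonNegative {X^ (n ∸ 1) · 2+2x} {∏∞}
  (·-nonNegative {X^ (n ∸ 1)} {2+2x} (X^-nonNegative (n ∸ 1))
    (λ k → ℤ.+-mono-≤ (const-nonNegative 2 k) (·-nonNegative {const (+ 2)} {x} (const-nonNegative 2) (X^-nonNegative 1) k)))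
  ∏∞-nonNegative

theorem6p12 : let B = p1324 ∷ p1342 ∷ [] in
    ∃ λ C → IsLimitGF B C ×
    (∀ k n → k + 7 ≤ 2 * n →
    let diff = + av (suc n) k B ℤ.- + av n k B in
    0ℤ ℤ.≤ diff
    × diff ≡ (xⁿ⁻¹[2+2x] n ⊛ C) k
    × xⁿ⁻¹[2+2x] n ⊛ C ≗ xⁿ⁻¹[2+2x] n ⊛ ∏[1+xⁱ]/[1-xⁱ]
    × + av n k B ≡ ((const 1ℤ ⊖ X^ 1 ⊖ xⁿ⁻¹[2+2x] n) ⊛ 1/[1-x] ⊛ ∏[1+xⁱ]/[1-xⁱ]) k)
theorem6p12 = ∏∞ , (λ k → k + 7 , λ n k+7≤n → trans (av≡Γ n k) (Γ-limit k n k+7≤n)) ,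
  λ k n k+7≤2n →
    let diff≡ = trans (cong₂ ℤ._-_ (av≡Γ (suc n) k) (av≡Γ n k)) (difference k n k+7≤2n) in
    subst (0ℤ ℤ.≤_) (sym diff≡) (difference-nonNegative n k) ,
    trans diff≡ (sym (trans (⊛≗· (xⁿ⁻¹[2+2x] n) ∏∞ k) (·-congʳ ∏∞ (xⁿ⁻¹[2+2x]≗ n) k))) ,
    -- The witness for the limit generating function is the infinite product itself.
    (λ _ → refl) ,
    trans (av≡Γ n k) (trans (Γ-diagonal-coefficient k n k+7≤2n) (sym (statement≗ n k)))
  where
  statement≗ : ∀ n → (const 1ℤ ⊖ X^ 1 ⊖ xⁿ⁻¹[2+2x] n) ⊛ 1/[1-x] ⊛ ∏∞ ≗ seriesFor n
  statement≗ n = ≗-trans (⊛≗· _ ∏∞) (·-congʳ ∏∞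
    (≗-trans (⊛≗· _ 1/[1-x]) (·-congʳ 1/[1-x] (⊖-congˡ 1-x (xⁿ⁻¹[2+2x]≗ n)))))
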